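{- Let $\Gamma$ be a finite oriented simplicial complex on $n$ vertices, let $k>0$, let $\ell\ge1$ be an integer, and let $d_{\mathrm{up}}$ denote the maximum up-degree of a $k$-simplex of $\Gamma$. Then $$\Big(1-\frac{d_{\mathrm{up}}+k+1}{n}\Big)^{\ell}\frac{1}{|S_k|}\sum_{\sigma\in S_k}\|H|\sigma\rangle\|_1^{\ell}\;\le\;\mathbb{E}\big[|f_k(\overline{\boldsymbol\sigma})|^2\big]\;\le\;\frac{1}{|S_k|}\sum_{\sigma\in S_k}\|H|\sigma\rangle\|_1^{2\ell}.$$ Moreover, if $\overline{\sigma}_1,\dots,\overline{\sigma}_{N_p}$ are independent samples of $\overline{\boldsymbol\sigma}$ with $$N_p\ge\frac{1}{\eta\epsilon^2}\cdot\frac{1}{|S_k|}\sum_{\sigma\in S_k}\|H|\sigma\rangle\|_1^{2\ell},$$ then $\frac{1}{N_p}\sum_{i=1}^{N_p}f_k(\overline{\sigma}_i)$ is an $(\epsilon,\eta)$-estimate of $\frac{1}{|S_k|}\mathrm{tr}(H^\ell)$.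
   Context: A simplicial complex $\Gamma$ on vertex set $\{x_1,\dots,x_n\}$ is a family of subsets closed under taking subsets; $S_k$ is the set of its elements of size $k+1$ ($k$-simplices). It is oriented via $x_1<\dots<x_n$. The boundary map $\partial_k:\mathbb{C}S_k\to\mathbb{C}S_{k-1}$ sends $|\{x_{i_0},\dots,x_{i_k}\}\rangle$ ($i_0<\dots<i_k$) to $\sum_{j=0}^k(-1)^{j+1}|\{x_{i_0},\dots,x_{i_k}\}\setminus\{x_{i_j}\}\rangle$. $\Delta_k$ is the matrix of $\partial_k^\dagger\partial_k+\partial_{k+1}\partial_{k+1}^\dagger$ in the basis $\{|\sigma\rangle:\sigma\in S_k\}$, and $H=I-\frac1n\Delta_k$; $\|H|\sigma\rangle\|_1=\sum_{\tau}|H_{\tau\sigma}|$. The up-degree of $\sigma\in S_k$ is the number of $(k+1)$-simplices containing it. Define the Markov chain on $S_k$ with $P_{\sigma\tau}=|\langle\tau|H|\sigma\rangle|/\|H|\sigma\rangle\|_1$. The random path $\overline{\boldsymbol\sigma}=(\sigma_0,\dots,\sigma_\ell)$ has $\sigma_0$ uniform on $S_k$ and $\sigma_{i+1}$ drawn from $P_{\sigma_i,\cdot}$, i.e. has probability $p(\overline\sigma)=\frac{1}{|S_k|}\prod_{i=0}^{\ell-1}P_{\sigma_i\sigma_{i+1}}$. Define $f_k(\sigma_0,\dots,\sigma_\ell)=\langle\sigma_\ell|\sigma_0\rangle\prod_{i=0}^{\ell-1}(-1)^{s(\sigma_i,\sigma_{i+1})}\|H|\sigma_i\rangle\|_1$,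 where $\langle\sigma_\ell|\sigma_0\rangle$ is $1$ if $\sigma_\ell=\sigma_0$ and $0$ otherwise, and $(-1)^{s(\sigma_i,\sigma_{i+1})}$ is the sign of $\langle\sigma_i|H|\sigma_{i+1}\rangle$. A random variable $X$ is an $(\epsilon,\eta)$-estimate of $\mu\in\mathbb{R}$ if $\Pr[|X-\mu|>\epsilon]<\eta$.
   Formalization: The accuracy ε and the failure probability η are taken to be positive rational numbers instead of positive reals. -}

module Defs where

open import Data.Bool using (Bool; true; false; if_then_else_; _∧_; T)
open import Data.Nat as ℕ using (ℕ; zero; suc)
open import Data.Integer as ℤ using (ℤ; +_; -[1+_])
open import Data.Rational as ℚ using (ℚ; 0ℚ; 1ℚ; _+_; _*_; _-_; _<_; _≤_; ∣_∣; _÷_)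
open import Data.Rational.Properties as ℚP using ()
open import Data.Fin.Subset using (Subset; _⊆_) renaming (∣_∣ to card)
open import Data.Vec using (Vec; []; _∷_)
open import Data.List using (List; []; _∷_; map; filter; length; concatMap; foldr)
open import Data.Product using (_×_; _,_)
open import Relation.Nullary using (yes; no; ¬_)
open import Relation.Nullary.Decidable using (⌊_⌋)
open import Relation.Unary using (Decidable)

Σ[_] : {A : Set} → List A → (A → ℚ) → ℚ
Σ[ xs ] f = foldr (λ x acc → f x + acc) 0ℚ xs

Π[_] : {A : Set} → List A → (A → ℚ) → ℚ
Π[ xs ] f = foldr (λ x acc → f x * acc) 1ℚ xs

_^ℚ_ : ℚ → ℕ → ℚ
q ^ℚ zero  = 1ℚ
q ^ℚ suc m = q * (q ^ℚ m)

-- total division: p / 0 := 0 (only used where the paper's division is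
-- by a quantity it implicitly assumes nonzero)
_/ₜ_ : ℚ → ℚ → ℚ
p /ₜ q with q ℚP.≟ 0ℚ
... | yes _ = 0ℚ
... | no q≢0 = _÷_ p q {{ℚ.≢-nonZero q≢0}}

ℕ→ℚ : ℕ → ℚ
ℕ→ℚ m = ℚ._/_ (+ m) 1

ℤ→ℚ : ℤ → ℚ
ℤ→ℚ z = ℚ._/_ z 1

-- Subsets of the vertex set {x₁,…,xₙ} (index i : Fin n ↔ vertex x_{i+1})

allSubsets : (n : ℕ) → List (Subset n)
allSubsets zero    = [] ∷ []
allSubsets (suc n) = map (false ∷_) (allSubsets n) Data.List.++ map (true ∷_) (allSubsets n)

_==ˢ_ : {n : ℕ} → Subset n → Subset n → Bool
[] ==ˢ [] = true
(a ∷ s) ==ˢ (b ∷ t) = eqB a b ∧ (s ==ˢ t)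
  where
  eqB : Bool → Bool → Bool
  eqB true true = true
  eqB false false = true
  eqB _ _ = false

_⊆ᵇ_ : {n : ℕ} → Subset n → Subset n → Bool
[] ⊆ᵇ [] = true
(true ∷ s) ⊆ᵇ (false ∷ t) = false
(_ ∷ s) ⊆ᵇ (_ ∷ t) = s ⊆ᵇ t

_==ℕ_ : ℕ → ℕ → Bool
m ==ℕ k = ⌊ m ℕ.≟ k ⌋

δ : {n : ℕ} → Subset n → Subset n → ℚ
δ σ τ = if σ ==ˢ τ then 1ℚ else 0ℚ

record SimplicialComplex (n : ℕ) : Set where
  field
    mem    : Subset n → Bool
    closed : ∀ s t → t ⊆ s → T (mem s) → T (mem t)

open SimplicialComplex public

S : {n : ℕ} → SimplicialComplex n → ℕ → List (Subset n)
S {n} Γ k = filter (λ s → T? (mem Γ s ∧ (card s ==ℕ suc k))) (allSubsets n)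
  where
  T? : (b : Bool) → Relation.Nullary.Dec (T b)
  T? true = yes _
  T? false = no (λ ())

-- faces' j σ : the list of pairs ((-1)^(j'+1), σ \ {x_{i_j'}}) where j' runs
-- over the positions (in increasing vertex order) of the elements of σ,
-- shifted by j elements already seen.
sgn : ℕ → ℤ
sgn zero = + 1
sgn (suc j) = ℤ.- sgn j

faces' : {m : ℕ} → ℕ → Subset m → List (ℤ × Subset m)
faces' j [] = []
faces' j (false ∷ s) = map (λ { (c , t) → (c , false ∷ t) }) (faces' j s)
faces' j (true ∷ s)  = (sgn (suc j) , false ∷ s)
                       ∷ map (λ { (c , t) → (c , true ∷ t) }) (faces' (suc j) s)

-- ∂|σ⟩ = Σ_j (-1)^{j+1} |σ \ {x_{i_j}}⟩
faces : {n : ℕ} → Subset n → List (ℤ × Subset n)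
faces = faces' 0

bd : {n : ℕ} → Subset n → Subset n → ℚ
bd τ σ = Σ[ faces σ ] (λ { (c , t) → if t ==ˢ τ then ℤ→ℚ c else 0ℚ })

-- combinatorial Laplacian Δ_k = ∂_k^† ∂_k + ∂_{k+1} ∂_{k+1}^† (real entries,
-- so † is transpose); entry ⟨σ|Δ_k|σ'⟩ for k > 0
Lap : {n : ℕ} → SimplicialComplex n → (k : ℕ) → Subset n → Subset n → ℚ
Lap Γ zero σ σ' =  -- not used (k > 0 in the theorem); ∂_0 term omitted
  Σ[ S Γ 1 ] (λ ρ → bd σ ρ * bd σ' ρ)
Lap Γ (suc k) σ σ' =
  Σ[ S Γ k ] (λ τ → bd τ σ * bd τ σ')
  + Σ[ S Γ (suc (suc k)) ] (λ ρ → bd σ ρ * bd σ' ρ)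

Hm : {n : ℕ} → SimplicialComplex n → ℕ → Subset n → Subset n → ℚ
Hm {n} Γ k σ σ' = δ σ σ' - (Lap Γ k σ σ' /ₜ ℕ→ℚ n)

norm1 : {n : ℕ} → SimplicialComplex n → ℕ → Subset n → ℚ
norm1 Γ k σ = Σ[ S Γ k ] (λ τ → ∣ Hm Γ k τ σ ∣)

updeg : {n : ℕ} → SimplicialComplex n → ℕ → Subset n → ℕ
updeg Γ k σ = length (filter (λ ρ → T? (σ ⊆ᵇ ρ)) (S Γ (suc k)))
  where
  T? : (b : Bool) → Relation.Nullary.Dec (T b)
  T? true = yes _
  T? false = no (λ ())

dup : {n : ℕ} → SimplicialComplex n → ℕ → ℕ
dup Γ k = foldr (λ σ acc → updeg Γ k σ ℕ.⊔ acc) 0 (S Γ k)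

Hpow : {n : ℕ} → SimplicialComplex n → ℕ → ℕ → Subset n → Subset n → ℚ
Hpow Γ k zero σ τ = δ σ τ
Hpow Γ k (suc m) σ τ = Σ[ S Γ k ] (λ ρ → Hm Γ k σ ρ * Hpow Γ k m ρ τ)

trHpow : {n : ℕ} → SimplicialComplex n → ℕ → ℕ → ℚ
trHpow Γ k ℓ = Σ[ S Γ k ] (λ σ → Hpow Γ k ℓ σ σ)

-- P_{στ} = |⟨τ|H|σ⟩| / ‖H|σ⟩‖₁   (convention: if ‖H|σ⟩‖₁ = 0, stay at σ)
Pm : {n : ℕ} → SimplicialComplex n → ℕ → Subset n → Subset n → ℚ
Pm Γ k σ τ with norm1 Γ k σ ℚP.≟ 0ℚ
... | yes _ = δ σ τ
... | no _  = ∣ Hm Γ k τ σ ∣ /ₜ norm1 Γ k σ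

seqs : {A : Set} → ℕ → List A → List (List A)
seqs zero xs = [] ∷ []
seqs (suc m) xs = concatMap (λ x → map (x ∷_) (seqs m xs)) xs

steps : {A : Set} → List A → List (A × A)
steps [] = []
steps (x ∷ []) = []
steps (x ∷ y ∷ xs) = (x , y) ∷ steps (y ∷ xs)

-- first and last element (paths are nonempty when used)
headOr lastOr : {A : Set} → A → List A → A
headOr d [] = d
headOr d (x ∷ _) = x
lastOr d [] = d
lastOr d (x ∷ []) = x
lastOr d (_ ∷ y ∷ xs) = lastOr d (y ∷ xs)

Paths : {n : ℕ} → SimplicialComplex n → ℕ → ℕ → List (List (Subset n))
Paths Γ k ℓ = seqs (suc ℓ) (S Γ k)

prob : {n : ℕ} → SimplicialComplex n → ℕ → List (Subset n) → ℚ
prob Γ k path = (1ℚ /ₜ ℕ→ℚ (length (S Γ k))) * Π[ steps path ] (λ { (a , b) → Pm Γ k a b })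

-- (-1)^{s(σ,τ)} : sign of ⟨σ|H|τ⟩ (sign of 0 taken as +1)
sgnH : {n : ℕ} → SimplicialComplex n → ℕ → Subset n → Subset n → ℚ
sgnH Γ k σ τ = if ⌊ Hm Γ k σ τ ℚP.<? 0ℚ ⌋ then ℚ.- 1ℚ else 1ℚ

fk : {n : ℕ} → SimplicialComplex n → ℕ → List (Subset n) → ℚ
fk {n} Γ k [] = 0ℚ
fk {n} Γ k path@(σ₀ ∷ _) =
  δ (lastOr σ₀ path) σ₀ * Π[ steps path ] (λ { (a , b) → sgnH Γ k a b * norm1 Γ k a })

Ef2 : {n : ℕ} → SimplicialComplex n → ℕ → ℕ → ℚ
Ef2 Γ k ℓ = Σ[ Paths Γ k ℓ ] (λ path → prob Γ k path * (fk Γ k path * fk Γ k path))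

avgNormPow : {n : ℕ} → SimplicialComplex n → ℕ → ℕ → ℚ
avgNormPow Γ k m = (1ℚ /ₜ ℕ→ℚ (length (S Γ k))) * Σ[ S Γ k ] (λ σ → norm1 Γ k σ ^ℚ m)

PrDev : {n : ℕ} → SimplicialComplex n → ℕ → ℕ → (N : ℕ) → (μ ε : ℚ) → ℚ
PrDev Γ k ℓ N μ ε =
  Σ[ seqs N (Paths Γ k ℓ) ] (λ samples →
     if ⌊ ε ℚP.<? ∣ (Σ[ samples ] (fk Γ k) /ₜ ℕ→ℚ N) - μ ∣ ⌋
     then Π[ samples ] (prob Γ k)
     else 0ℚ)

avgTr : {n : ℕ} → SimplicialComplex n → ℕ → ℕ → ℚ
avgTr Γ k ℓ = trHpow Γ k ℓ /ₜ ℕ→ℚ (length (S Γ k))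

{-# OPTIONS --safe #-}

-- Write H = Hm Γ k and N σ = norm1 Γ k σ. Unfolding the path measure gives
--   E[f] = (1/|S|) tr (H^ℓ)   and   E[f²] = (1/|S|) Σ over closed walks of Π P(σᵢ,σᵢ₊₁) N(σᵢ)².
-- Keeping only the constant walks gives the lower bound: the factor at σ is then
-- |H σσ| N(σ), and H σσ ≥ 1 - (dup + k + 1)/n because the diagonal entry of the Laplacian
-- counts the facets and the cofaces of σ; this lower bound is nonnegative because every
-- coface adds a different vertex.
-- For the upper bound, AM-GM gives Π N(σᵢ)² ≤ (1/ℓ) Σᵢ N(σᵢ)^(2ℓ). By cyclicity of closed
-- walks each of the ℓ terms contributes Σ_σ N(σ)^(2ℓ) (P^ℓ)(σ,σ), and (P^ℓ)(σ,σ) ≤ 1 as P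
-- is stochastic.
-- The estimate is Chebyshev's inequality; its strict form holds because the deviation
-- event is itself strict and η > 0.
module Submission where

open import Defs
open import Data.Bool using (true; false; if_then_else_; T)
import Data.Bool.Properties as BoolP
open import Data.Fin.Subset using (Subset) renaming (∣_∣ to card)
import Data.Fin.Subset.Properties as SubsetP
open import Data.Integer as ℤ using (ℤ)
import Data.Integer.Properties as ℤP
open import Data.List using (List; []; _∷_; _++_; map; filter; length; concatMap; foldr)
import Data.List.Properties as ListP
open import Data.List.Membership.Propositional using (_∈_; find)
open import Data.List.Membership.Propositional.Properties using (∈-∃++; ∈-map⁻; ∈-concatMap⁻; ∈-filter⁻)
open import Data.List.Relation.Unary.All as All using ()
open import Data.List.Relation.Unary.AllPairs using ([]; _∷_)
open import Data.List.Relation.Unary.Any using (here; there)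
open import Data.List.Relation.Unary.Unique.Propositional using (Unique)
import Data.List.Relation.Unary.Unique.Propositional.Properties as UniqueP
open import Data.Nat as ℕ using (ℕ; zero; suc)
import Data.Nat.Coprimality as Coprimality
import Data.Nat.Properties as ℕP
open import Data.Product using (_×_; _,_; proj₁; proj₂; uncurry; ∃)
open import Data.Rational as ℚ using (ℚ; mkℚ; 0ℚ; 1ℚ; _+_; _*_; _-_; _<_; _≤_; ∣_∣)
open import Data.Rational.Properties as ℚP using (≤-refl; ≤-trans; ≤-reflexive)
open import Data.Sum using (_⊎_; inj₁; inj₂; [_,_]′)
open import Data.Vec using ([]; _∷_)
import Data.Vec.Properties as VecP
open import Function using (_∘_; case_of_)
open import Function.Bundles using (Equivalence)
open import Relation.Binary.PropositionalEquality
open import Relation.Nullary using (yes; no; ¬_; contradiction)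
open import Relation.Nullary.Decidable using (⌊_⌋; dec⇒maybe; decidable-stable; toWitness)
open import Relation.Unary using (Decidable)
open import Tactic.RingSolver using (solve-∀)
open import Tactic.RingSolver.Core.AlmostCommutativeRing using (AlmostCommutativeRing; fromCommutativeRing)

-- The indicator that a walk closes has to survive until the walk has been rotated. `P` has row sums
-- 1 but its column sums are not controlled, so the mass that open walks, summed over all starting
-- points, carry to σ after i steps may exceed 1; a diagonal entry of a power of `P` cannot. The
-- numbers are rational, so every inequality is kept polynomial: AM-GM is used as m Π u ≤ Σ u^m,
-- without roots, and comes from Chebyshev's sum inequality rather than from convexity. Quotients
-- are removed in the same spirit: the identity P(σ,τ) N(σ) = |H τσ| takes the place of the
-- definition of `P`. It survives the convention at N(σ) = 0, since the whole column of H is then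
-- zero. Two degenerate cases escape the Chebyshev argument. Without k-simplices the total
-- probability is 0 instead of 1. And zero samples are admissible only if all norms vanish, in which
-- case the trace and the empty average are both 0.

private variable
  A B : Set
  a b c d : ℚ
  n : ℕ

-- Rational arithmetic and finite sums

ℚ-ring : AlmostCommutativeRing _ _
ℚ-ring = fromCommutativeRing ℚP.+-*-commutativeRing (λ x → dec⇒maybe (0ℚ ℚP.≟ x))

*-monoˡ-≤ : 0ℚ ≤ c → a ≤ b → c * a ≤ c * b
*-monoˡ-≤ {c} 0≤c = ℚP.*-monoˡ-≤-nonNeg c {{ℚ.nonNegative 0≤c}}

*-monoʳ-≤ : 0ℚ ≤ c → a ≤ b → a * c ≤ b * c
*-monoʳ-≤ {c} 0≤c = ℚP.*-monoʳ-≤-nonNeg c {{ℚ.nonNegative 0≤c}}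

*-mono-≤ : 0ℚ ≤ a → 0ℚ ≤ d → a ≤ b → c ≤ d → a * c ≤ b * d
*-mono-≤ 0≤a 0≤d a≤b c≤d = ≤-trans (*-monoˡ-≤ 0≤a c≤d) (*-monoʳ-≤ 0≤d a≤b)

*-nonneg : 0ℚ ≤ a → 0ℚ ≤ b → 0ℚ ≤ a * b
*-nonneg {a} 0≤a 0≤b = subst₂ _≤_ (ℚP.*-zeroʳ a) refl (*-monoˡ-≤ 0≤a 0≤b)

*-pos : 0ℚ < a → 0ℚ < b → 0ℚ < a * b
*-pos {a} {b} 0<a 0<b =
  ℚP.positive⁻¹ _ {{ℚP.pos*pos⇒pos a {{ℚ.positive 0<a}} b {{ℚ.positive 0<b}}}}

*-cancelʳ-≤ : 0ℚ < c → a * c ≤ b * c → a ≤ b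
*-cancelʳ-≤ {c} 0<c = ℚP.*-cancelʳ-≤-pos c {{ℚ.positive 0<c}}

*-cancelʳ-< : 0ℚ ≤ c → a * c < b * c → a < b
*-cancelʳ-< {c} 0≤c = ℚP.*-cancelʳ-<-nonNeg c {{ℚ.nonNegative 0≤c}}

*-monoˡ-< : 0ℚ < c → a < b → c * a < c * b
*-monoˡ-< {c} 0<c = ℚP.*-monoʳ-<-pos c {{ℚ.positive 0<c}}

*-monoʳ-< : 0ℚ < c → a < b → a * c < b * c
*-monoʳ-< {c} 0<c = ℚP.*-monoˡ-<-pos c {{ℚ.positive 0<c}}

+-nonneg : 0ℚ ≤ a → 0ℚ ≤ b → 0ℚ ≤ a + b
+-nonneg = ℚP.+-mono-≤

p≤p+q : 0ℚ ≤ b → a ≤ a + b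
p≤p+q {b} {a} 0≤b = subst₂ _≤_ (ℚP.+-identityʳ a) refl (ℚP.+-monoʳ-≤ a 0≤b)

∣p∣*∣p∣≡p*p : ∀ p → ∣ p ∣ * ∣ p ∣ ≡ p * p
∣p∣*∣p∣≡p*p p with ℚP.∣p∣≡p∨∣p∣≡-p p
... | inj₁ eq rewrite eq = refl
... | inj₂ eq rewrite eq = lemma p
  where
  lemma : ∀ p → ℚ.- p * ℚ.- p ≡ p * p
  lemma = solve-∀ ℚ-ring

square-nonneg : ∀ p → 0ℚ ≤ p * p
square-nonneg p = subst (0ℚ ≤_) (∣p∣*∣p∣≡p*p p) (*-nonneg (ℚP.0≤∣p∣ p) (ℚP.0≤∣p∣ p))

p≤∣p∣ : ∀ p → p ≤ ∣ p ∣
p≤∣p∣ p with ℚP.≤-total 0ℚ p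
... | inj₁ 0≤p = ≤-reflexive (sym (ℚP.0≤p⇒∣p∣≡p 0≤p))
... | inj₂ p≤0 = ≤-trans p≤0 (ℚP.0≤∣p∣ p)

<∣∣⇒square< : 0ℚ < a → a < ∣ b ∣ → a * a < b * b
<∣∣⇒square< {a} {b} 0<a a<∣b∣ = subst (a * a <_) (∣p∣*∣p∣≡p*p b)
  (ℚP.<-trans (*-monoˡ-< 0<a a<∣b∣) (*-monoʳ-< (ℚP.<-trans 0<a a<∣b∣) a<∣b∣))

≤⇒0≤- : a ≤ b → 0ℚ ≤ b - a
≤⇒0≤- {a} {b} a≤b = subst (_≤ b - a) (ℚP.+-inverseʳ a) (ℚP.+-monoˡ-≤ (ℚ.- a) a≤b)

0≤-⇒≤ : 0ℚ ≤ b - a → a ≤ b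
0≤-⇒≤ {b} {a} h = subst₂ _≤_ (ℚP.+-identityˡ a) (lemma a b) (ℚP.+-monoˡ-≤ a h)
  where
  lemma : ∀ a b → b - a + a ≡ b
  lemma = solve-∀ ℚ-ring

^-nonneg : ∀ m → 0ℚ ≤ a → 0ℚ ≤ a ^ℚ m
^-nonneg zero    _   = ℚP.nonNegative⁻¹ 1ℚ
^-nonneg (suc m) 0≤a = *-nonneg 0≤a (^-nonneg m 0≤a)

^-monoˡ : ∀ m → 0ℚ ≤ a → a ≤ b → a ^ℚ m ≤ b ^ℚ m
^-monoˡ zero    _   _   = ≤-refl
^-monoˡ (suc m) 0≤a a≤b =
  *-mono-≤ 0≤a (^-nonneg m (≤-trans 0≤a a≤b)) a≤b (^-monoˡ m 0≤a a≤b)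

^-distribˡ-+ : ∀ a m n → a ^ℚ (m ℕ.+ n) ≡ a ^ℚ m * a ^ℚ n
^-distribˡ-+ a zero    n = sym (ℚP.*-identityˡ _)
^-distribˡ-+ a (suc m) n = trans (cong (a *_) (^-distribˡ-+ a m n)) (sym (ℚP.*-assoc a _ _))

^-distribʳ-* : ∀ m a b → (a * b) ^ℚ m ≡ a ^ℚ m * b ^ℚ m
^-distribʳ-* zero    a b = sym (ℚP.*-identityˡ 1ℚ)
^-distribʳ-* (suc m) a b =
  trans (cong (a * b *_) (^-distribʳ-* m a b)) (lemma a b (a ^ℚ m) (b ^ℚ m))
  where
  lemma : ∀ a b c d → a * b * (c * d) ≡ a * c * (b * d)
  lemma = solve-∀ ℚ-ring

-- `ℕ→ℚ` normalises by a gcd, which is stuck on a variable; with numerator and denominator explicit,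
-- addition reduces.
ℕ→ℚ≡mkℚ : ∀ m → ℕ→ℚ m ≡ mkℚ (ℤ.+ m) 0 (Coprimality.sym (Coprimality.1-coprimeTo m))
ℕ→ℚ≡mkℚ m = ℚP.normalize-coprime (Coprimality.sym (Coprimality.1-coprimeTo m))

ℕ→ℚ-+ : ∀ m n → ℕ→ℚ (m ℕ.+ n) ≡ ℕ→ℚ m + ℕ→ℚ n
ℕ→ℚ-+ m n rewrite ℕ→ℚ≡mkℚ m | ℕ→ℚ≡mkℚ n =
  cong (λ z → z ℚ./ 1) (sym (cong₂ ℤ._+_ (ℤP.*-identityʳ (ℤ.+ m)) (ℤP.*-identityʳ (ℤ.+ n))))

ℕ→ℚ-suc : ∀ m → ℕ→ℚ (suc m) ≡ 1ℚ + ℕ→ℚ m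
ℕ→ℚ-suc = ℕ→ℚ-+ 1

ℕ→ℚ-nonneg : ∀ m → 0ℚ ≤ ℕ→ℚ m
ℕ→ℚ-nonneg m = ℚP.nonNegative⁻¹ _ {{ℚP.normalize-nonNeg m 1}}

ℕ→ℚ-pos : ∀ m → 0ℚ < ℕ→ℚ (suc m)
ℕ→ℚ-pos m = ℚP.positive⁻¹ _ {{ℚP.normalize-pos (suc m) 1}}

ℕ→ℚ-mono : ∀ {m n} → m ℕ.≤ n → ℕ→ℚ m ≤ ℕ→ℚ n
ℕ→ℚ-mono {m} {n} m≤n = subst (ℕ→ℚ m ≤_)
  (trans (sym (ℕ→ℚ-+ m (n ℕ.∸ m))) (cong ℕ→ℚ (ℕP.m+[n∸m]≡n m≤n)))
  (p≤p+q (ℕ→ℚ-nonneg (n ℕ.∸ m)))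

/ₜ-zero : ∀ p → p /ₜ 0ℚ ≡ 0ℚ
/ₜ-zero p with 0ℚ ℚP.≟ 0ℚ
... | yes _   = refl
... | no  0≢0 = contradiction refl 0≢0

-- At `q ≡ 0ℚ` both sides vanish by the convention of `/ₜ`, so division can be traded for
-- multiplication without a case distinction.
/ₜ≡*1/ₜ : ∀ p q → p /ₜ q ≡ p * (1ℚ /ₜ q)
/ₜ≡*1/ₜ p q with q ℚP.≟ 0ℚ
... | yes _   = sym (ℚP.*-zeroʳ p)
... | no  q≢0 = cong (p *_) (sym (ℚP.*-identityˡ _))

/ₜ-*-cancel : ∀ p {q} → q ≢ 0ℚ → (p /ₜ q) * q ≡ p
/ₜ-*-cancel p {q} q≢0 with q ℚP.≟ 0ℚ
... | yes q≡0  = contradiction q≡0 q≢0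
... | no  q≢0′ = trans (ℚP.*-assoc p _ q)
  (trans (cong (p *_) (ℚP.*-inverseˡ q {{ℚ.≢-nonZero q≢0′}})) (ℚP.*-identityʳ p))

pos⇒≢0 : 0ℚ < a → a ≢ 0ℚ
pos⇒≢0 0<a a≡0 = ℚP.<⇒≢ 0<a (sym a≡0)

nonneg∧≢0⇒pos : 0ℚ ≤ a → a ≢ 0ℚ → 0ℚ < a
nonneg∧≢0⇒pos {a} 0≤a a≢0 with 0ℚ ℚP.<? a
... | yes 0<a = 0<a
... | no  0≮a = contradiction (ℚP.≤-antisym (ℚP.≮⇒≥ 0≮a) 0≤a) a≢0

1/ₜ-nonneg : 0ℚ ≤ a → 0ℚ ≤ 1ℚ /ₜ a
1/ₜ-nonneg {a} 0≤a = case a ℚP.≟ 0ℚ of λ where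
  (yes refl) → ≤-reflexive (sym (/ₜ-zero 1ℚ))
  (no  a≢0)  → *-cancelʳ-≤ (nonneg∧≢0⇒pos 0≤a a≢0)
    (subst₂ _≤_ (sym (ℚP.*-zeroˡ a)) (sym (/ₜ-*-cancel 1ℚ a≢0)) (ℚP.nonNegative⁻¹ 1ℚ))

/ₜ-nonneg : 0ℚ ≤ a → 0ℚ ≤ b → 0ℚ ≤ a /ₜ b
/ₜ-nonneg {a} {b} 0≤a 0≤b =
  subst (0ℚ ≤_) (sym (/ₜ≡*1/ₜ a b)) (*-nonneg 0≤a (1/ₜ-nonneg 0≤b))

/ₜ-monoˡ : 0ℚ ≤ c → a ≤ b → a /ₜ c ≤ b /ₜ c
/ₜ-monoˡ {c} {a} {b} 0≤c a≤b =
  subst₂ _≤_ (sym (/ₜ≡*1/ₜ a c)) (sym (/ₜ≡*1/ₜ b c)) (*-monoʳ-≤ (1/ₜ-nonneg 0≤c) a≤b)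

-- Clears the denominator in the bound on the number of samples.
1/ₜ-*-≤ : 0ℚ < c → (1ℚ /ₜ c) * a ≤ b → a ≤ c * b
1/ₜ-*-≤ {c} {a} {b} 0<c h = subst₂ _≤_ eq (ℚP.*-comm b c) (*-monoʳ-≤ (ℚP.<⇒≤ 0<c) h)
  where
  lemma : ∀ i a c → i * a * c ≡ i * c * a
  lemma = solve-∀ ℚ-ring
  eq : (1ℚ /ₜ c) * a * c ≡ a
  eq = trans (lemma (1ℚ /ₜ c) a c)
    (trans (cong (_* a) (/ₜ-*-cancel 1ℚ (pos⇒≢0 0<c))) (ℚP.*-identityˡ a))

Σ-cong : ∀ {f g : A → ℚ} xs → (∀ x → x ∈ xs → f x ≡ g x) → Σ[ xs ] f ≡ Σ[ xs ] g
Σ-cong []       _  = refl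
Σ-cong (x ∷ xs) eq = cong₂ _+_ (eq x (here refl)) (Σ-cong xs (λ y y∈ → eq y (there y∈)))

Σ-mono : ∀ {f g : A → ℚ} xs → (∀ x → x ∈ xs → f x ≤ g x) → Σ[ xs ] f ≤ Σ[ xs ] g
Σ-mono []       _ = ≤-refl
Σ-mono (x ∷ xs) h = ℚP.+-mono-≤ (h x (here refl)) (Σ-mono xs (λ y y∈ → h y (there y∈)))

Σ-zero : ∀ (xs : List A) → Σ[ xs ] (λ _ → 0ℚ) ≡ 0ℚ
Σ-zero []       = refl
Σ-zero (x ∷ xs) = trans (ℚP.+-identityˡ _) (Σ-zero xs)

Σ-nonneg : ∀ {f : A → ℚ} xs → (∀ x → x ∈ xs → 0ℚ ≤ f x) → 0ℚ ≤ Σ[ xs ] f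
Σ-nonneg xs h = subst₂ _≤_ (Σ-zero xs) refl (Σ-mono xs h)

Σ-one : ∀ (xs : List A) → Σ[ xs ] (λ _ → 1ℚ) ≡ ℕ→ℚ (length xs)
Σ-one []       = refl
Σ-one (x ∷ xs) = trans (cong (1ℚ +_) (Σ-one xs)) (sym (ℕ→ℚ-suc (length xs)))

Σ-+ : ∀ (f g : A → ℚ) xs → Σ[ xs ] (λ x → f x + g x) ≡ Σ[ xs ] f + Σ[ xs ] g
Σ-+ f g []       = sym (ℚP.+-identityˡ 0ℚ)
Σ-+ f g (x ∷ xs) =
  trans (cong (f x + g x +_) (Σ-+ f g xs)) (lemma (f x) (g x) (Σ[ xs ] f) (Σ[ xs ] g))
  where
  lemma : ∀ a b c d → a + b + (c + d) ≡ a + c + (b + d)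
  lemma = solve-∀ ℚ-ring

Σ-*ˡ : ∀ c (f : A → ℚ) xs → Σ[ xs ] (λ x → c * f x) ≡ c * Σ[ xs ] f
Σ-*ˡ c f []       = sym (ℚP.*-zeroʳ c)
Σ-*ˡ c f (x ∷ xs) =
  trans (cong (c * f x +_) (Σ-*ˡ c f xs)) (sym (ℚP.*-distribˡ-+ c (f x) (Σ[ xs ] f)))

Σ-*ʳ : ∀ c (f : A → ℚ) xs → Σ[ xs ] (λ x → f x * c) ≡ Σ[ xs ] f * c
Σ-*ʳ c f xs = trans (Σ-cong xs (λ x _ → ℚP.*-comm (f x) c))
  (trans (Σ-*ˡ c f xs) (ℚP.*-comm c _))

Σ-swap : ∀ (f : A → B → ℚ) xs ys →
  Σ[ xs ] (λ x → Σ[ ys ] (f x)) ≡ Σ[ ys ] (λ y → Σ[ xs ] (λ x → f x y))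
Σ-swap f []       ys = sym (Σ-zero ys)
Σ-swap f (x ∷ xs) ys = trans (cong (Σ[ ys ] (f x) +_) (Σ-swap f xs ys))
  (sym (Σ-+ (f x) (λ y → Σ[ xs ] (λ x → f x y)) ys))

Σ-++ : ∀ (f : A → ℚ) xs ys → Σ[ xs ++ ys ] f ≡ Σ[ xs ] f + Σ[ ys ] f
Σ-++ f []       ys = sym (ℚP.+-identityˡ _)
Σ-++ f (x ∷ xs) ys = trans (cong (f x +_) (Σ-++ f xs ys)) (sym (ℚP.+-assoc (f x) _ _))

Σ-map : ∀ (f : B → ℚ) (g : A → B) xs → Σ[ map g xs ] f ≡ Σ[ xs ] (f ∘ g)
Σ-map f g []       = refl
Σ-map f g (x ∷ xs) = cong (f (g x) +_) (Σ-map f g xs)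

Σ-concatMap : ∀ (f : B → ℚ) (g : A → List B) xs →
  Σ[ concatMap g xs ] f ≡ Σ[ xs ] (λ x → Σ[ g x ] f)
Σ-concatMap f g []       = refl
Σ-concatMap f g (x ∷ xs) =
  trans (Σ-++ f (g x) (concatMap g xs)) (cong (Σ[ g x ] f +_) (Σ-concatMap f g xs))

Σ-filter-≤ : ∀ {P : A → Set} (P? : Decidable P) {f : A → ℚ} xs →
  (∀ x → 0ℚ ≤ f x) → Σ[ filter P? xs ] f ≤ Σ[ xs ] f
Σ-filter-≤ P? []       0≤f = ≤-refl
Σ-filter-≤ P? {f} (x ∷ xs) 0≤f with P? x
... | yes _ = ℚP.+-monoʳ-≤ (f x) (Σ-filter-≤ P? xs 0≤f)
... | no  _ = ≤-trans (Σ-filter-≤ P? xs 0≤f)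
  (subst (_≤ f x + Σ[ xs ] f) (ℚP.+-identityˡ _) (ℚP.+-monoˡ-≤ _ (0≤f x)))

∈⇒≤Σ : ∀ {f : A → ℚ} {x} xs → (∀ x → 0ℚ ≤ f x) → x ∈ xs → f x ≤ Σ[ xs ] f
∈⇒≤Σ (_ ∷ xs) 0≤f (here refl) = p≤p+q (Σ-nonneg xs (λ y _ → 0≤f y))
∈⇒≤Σ {f = f} (y ∷ xs) 0≤f (there x∈) = ≤-trans (∈⇒≤Σ xs 0≤f x∈)
  (subst (_≤ f y + Σ[ xs ] f) (ℚP.+-identityˡ _) (ℚP.+-monoˡ-≤ _ (0≤f y)))

Σ-seqs : ∀ (F : List A → ℚ) m xs →
  Σ[ seqs (suc m) xs ] F ≡ Σ[ xs ] (λ x → Σ[ seqs m xs ] (λ s → F (x ∷ s)))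
Σ-seqs F m xs = trans (Σ-concatMap F (λ x → map (x ∷_) (seqs m xs)) xs)
  (Σ-cong xs (λ x _ → Σ-map F (x ∷_) (seqs m xs)))

Π-cong : ∀ {f g : A → ℚ} xs → (∀ x → f x ≡ g x) → Π[ xs ] f ≡ Π[ xs ] g
Π-cong []       _  = refl
Π-cong (x ∷ xs) eq = cong₂ _*_ (eq x) (Π-cong xs eq)

Π-* : ∀ (f g : A → ℚ) xs → Π[ xs ] (λ x → f x * g x) ≡ Π[ xs ] f * Π[ xs ] g
Π-* f g []       = sym (ℚP.*-identityˡ 1ℚ)
Π-* f g (x ∷ xs) =
  trans (cong (f x * g x *_) (Π-* f g xs)) (lemma (f x) (g x) (Π[ xs ] f) (Π[ xs ] g))
  where
  lemma : ∀ a b c d → a * b * (c * d) ≡ a * c * (b * d)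
  lemma = solve-∀ ℚ-ring

Π-++ : ∀ (f : A → ℚ) xs ys → Π[ xs ++ ys ] f ≡ Π[ xs ] f * Π[ ys ] f
Π-++ f []       ys = sym (ℚP.*-identityˡ _)
Π-++ f (x ∷ xs) ys = trans (cong (f x *_) (Π-++ f xs ys)) (sym (ℚP.*-assoc (f x) _ _))

Π-nonneg : ∀ {f : A → ℚ} xs → (∀ x → 0ℚ ≤ f x) → 0ℚ ≤ Π[ xs ] f
Π-nonneg []       _   = ℚP.nonNegative⁻¹ 1ℚ
Π-nonneg (x ∷ xs) 0≤f = *-nonneg (0≤f x) (Π-nonneg xs 0≤f)

-- The AM-GM and Chebyshev inequalities

double-cancel-≤ : a + a ≤ b + b → a ≤ b
double-cancel-≤ {a} {b} h = *-cancelʳ-≤ {1ℚ + 1ℚ} (ℚP.positive⁻¹ (1ℚ + 1ℚ))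
  (subst₂ _≤_ (lemma a) (lemma b) h)
  where
  lemma : ∀ a → a + a ≡ a * (1ℚ + 1ℚ)
  lemma = solve-∀ ℚ-ring

-- The right side minus the left is `(b - a) * (b ^ℚ m - a ^ℚ m)`, and the two factors have the same
-- sign because powers are monotone on nonnegative numbers.
rearrangement-^ : ∀ m → 0ℚ ≤ a → 0ℚ ≤ b →
  a * b ^ℚ m + b * a ^ℚ m ≤ a ^ℚ suc m + b ^ℚ suc m
rearrangement-^ {a} {b} m 0≤a 0≤b = 0≤-⇒≤ (subst (0ℚ ≤_) (lemma a b (a ^ℚ m) (b ^ℚ m)) ordered)
  where
  lemma : ∀ a b x y → (b - a) * (y - x) ≡ a * x + b * y - (a * y + b * x)
  lemma = solve-∀ ℚ-ring
  flip : ∀ a b x y → (a - b) * (x - y) ≡ (b - a) * (y - x)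
  flip = solve-∀ ℚ-ring
  ordered : 0ℚ ≤ (b - a) * (b ^ℚ m - a ^ℚ m)
  ordered with ℚP.≤-total a b
  ... | inj₁ a≤b = *-nonneg (≤⇒0≤- a≤b) (≤⇒0≤- (^-monoˡ m 0≤a a≤b))
  ... | inj₂ b≤a = subst (0ℚ ≤_) (flip a b (a ^ℚ m) (b ^ℚ m))
    (*-nonneg (≤⇒0≤- b≤a) (≤⇒0≤- (^-monoˡ m 0≤b b≤a)))

Σ-Σ-* : ∀ (f : A → ℚ) (g : B → ℚ) xs ys →
  Σ[ xs ] (λ x → Σ[ ys ] (λ y → f x * g y)) ≡ Σ[ xs ] f * Σ[ ys ] g
Σ-Σ-* f g xs ys = trans (Σ-cong xs (λ x _ → Σ-*ˡ (f x) g ys)) (Σ-*ʳ (Σ[ ys ] g) f xs)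

Σ-const : ∀ c (xs : List A) → Σ[ xs ] (λ _ → c) ≡ ℕ→ℚ (length xs) * c
Σ-const c xs = trans (Σ-cong xs (λ _ _ → sym (ℚP.*-identityˡ c)))
  (trans (Σ-*ʳ c (λ _ → 1ℚ) xs) (cong (_* c) (Σ-one xs)))

Σ-Σ-+ : ∀ (f g : A → B → ℚ) xs ys → Σ[ xs ] (λ x → Σ[ ys ] (λ y → f x y + g x y))
  ≡ Σ[ xs ] (λ x → Σ[ ys ] (f x)) + Σ[ xs ] (λ x → Σ[ ys ] (g x))
Σ-Σ-+ f g xs ys = trans (Σ-cong xs (λ x _ → Σ-+ (f x) (g x) ys))
  (Σ-+ (λ x → Σ[ ys ] (f x)) (λ x → Σ[ ys ] (g x)) xs)

module _ (u : A → ℚ) (0≤u : ∀ x → 0ℚ ≤ u x) where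

  -- Chebyshev's sum inequality for two families in the same order. Summing the two-element case
  -- over all ordered pairs makes each side appear twice and avoids sorting the list.
  chebyshev-sum : ∀ m xs →
    Σ[ xs ] u * Σ[ xs ] (λ x → u x ^ℚ m) ≤ ℕ→ℚ (length xs) * Σ[ xs ] (λ x → u x ^ℚ suc m)
  chebyshev-sum m xs = subst₂ _≤_ (Σ-Σ-* u (λ y → u y ^ℚ m) xs xs) (Σ-const _ xs)
    (double-cancel-≤ (subst₂ _≤_ lhs rhs
      (Σ-mono xs (λ x _ → Σ-mono xs (λ y _ → rearrangement-^ m (0≤u x) (0≤u y))))))
    where
    off : A → A → ℚ
    off x y = u x * u y ^ℚ m
    power : A → ℚ
    power x = u x ^ℚ suc m
    lhs = trans (Σ-Σ-+ off (λ x y → off y x) xs xs)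
      (cong (Σ[ xs ] (λ x → Σ[ xs ] (off x)) +_) (Σ-swap (λ x y → off y x) xs xs))
    rhs : Σ[ xs ] (λ x → Σ[ xs ] (λ y → power x + power y))
      ≡ Σ[ xs ] (λ _ → Σ[ xs ] power) + Σ[ xs ] (λ _ → Σ[ xs ] power)
    rhs = trans (Σ-Σ-+ (λ x _ → power x) (λ _ y → power y) xs xs)
      (cong (_+ Σ[ xs ] (λ _ → Σ[ xs ] power)) (Σ-swap (λ x _ → power x) xs xs))

  -- AM-GM for the powers `u x ^ℚ m`, so that no root occurs. In the induction step the instances of
  -- `am-gm-without`, one for each omitted element, are added up: their right sides give `Σ[ xs ] u`
  -- times the sum of `m`-th powers minus the sum of `suc m`-th powers, which `chebyshev-sum`
  -- bounds.
  am-gm : ∀ m xs → length xs ≡ m → ℕ→ℚ m * Π[ xs ] u ≤ Σ[ xs ] (λ x → u x ^ℚ m)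

  -- The inequality for the other elements of the list, multiplied by the element x.
  am-gm-without : ∀ m xs → length xs ≡ suc m → ∀ x → x ∈ xs →
    ℕ→ℚ m * Π[ xs ] u ≤ u x * (Σ[ xs ] (λ y → u y ^ℚ m) - u x ^ℚ m)
  am-gm-without m xs len x x∈xs with ∈-∃++ x∈xs
  ... | as , bs , refl = subst₂ _≤_ lhs rhs (*-monoˡ-≤ (0≤u x) (am-gm m (as ++ bs) len′))
    where
    len′ : length (as ++ bs) ≡ m
    len′ = ℕP.suc-injective (trans (cong suc (ListP.length-++ as))
      (trans (sym (ℕP.+-suc (length as) (length bs))) (trans (sym (ListP.length-++ as)) len)))
    lemma₁ : ∀ m x p q → x * (m * (p * q)) ≡ m * (p * (x * q))
    lemma₁ = solve-∀ ℚ-ring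
    lemma₂ : ∀ x p q → p + q ≡ p + (x + q) - x
    lemma₂ = solve-∀ ℚ-ring
    lhs : u x * (ℕ→ℚ m * Π[ as ++ bs ] u) ≡ ℕ→ℚ m * Π[ as ++ x ∷ bs ] u
    lhs = trans (cong (λ z → u x * (ℕ→ℚ m * z)) (Π-++ u as bs))
      (trans (lemma₁ (ℕ→ℚ m) (u x) (Π[ as ] u) (Π[ bs ] u))
             (cong (ℕ→ℚ m *_) (sym (Π-++ u as (x ∷ bs)))))
    v : A → ℚ
    v y = u y ^ℚ m
    rhs : u x * Σ[ as ++ bs ] v ≡ u x * (Σ[ as ++ x ∷ bs ] v - v x)
    rhs = cong (u x *_) (trans (Σ-++ v as bs) (trans (lemma₂ (v x) (Σ[ as ] v) (Σ[ bs ] v))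
      (cong (_- v x) (sym (Σ-++ v as (x ∷ bs))))))

  am-gm zero          []           refl = ≤-reflexive (ℚP.*-zeroˡ 1ℚ)
  am-gm (suc zero)    (x ∷ [])     refl = ≤-reflexive (lemma (u x))
    where
    lemma : ∀ x → 1ℚ * (x * 1ℚ) ≡ x * 1ℚ + 0ℚ
    lemma = solve-∀ ℚ-ring
  -- The last step cancels the factor `ℕ→ℚ m`, which has to be positive; lists of length one are
  -- therefore a case of their own.
  am-gm (suc m@(suc n)) xs len = *-cancelʳ-≤ (ℕ→ℚ-pos n) (≤-trans (≤-reflexive lhs)
    (≤-trans (Σ-mono xs (am-gm-without m xs len)) (subst (_≤ S⁺ * ℕ→ℚ m) (sym rhs) bound)))
    where
    S⁺ = Σ[ xs ] (λ x → u x ^ℚ suc m)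
    Sm = Σ[ xs ] (λ x → u x ^ℚ m)
    lemma₁ : ∀ a b c → a * b * c ≡ a * (c * b)
    lemma₁ = solve-∀ ℚ-ring
    t = ℕ→ℚ m * Π[ xs ] u
    lhs : ℕ→ℚ (suc m) * Π[ xs ] u * ℕ→ℚ m ≡ Σ[ xs ] (λ _ → ℕ→ℚ m * Π[ xs ] u)
    lhs = trans (lemma₁ (ℕ→ℚ (suc m)) (Π[ xs ] u) (ℕ→ℚ m))
      (sym (trans (Σ-const t xs) (cong (λ k → ℕ→ℚ k * t) len)))
    lemma₂ : ∀ x s p → x * (s - p) ≡ x * s + ℚ.- 1ℚ * (x * p)
    lemma₂ = solve-∀ ℚ-ring
    rhs : Σ[ xs ] (λ x → u x * (Sm - u x ^ℚ m)) ≡ Σ[ xs ] u * Sm + ℚ.- 1ℚ * S⁺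
    rhs = trans (Σ-cong xs (λ x _ → lemma₂ (u x) Sm (u x ^ℚ m)))
      (trans (Σ-+ (λ x → u x * Sm) (λ x → ℚ.- 1ℚ * (u x * u x ^ℚ m)) xs)
        (cong₂ _+_ (Σ-*ʳ Sm u xs) (Σ-*ˡ (ℚ.- 1ℚ) (λ x → u x * u x ^ℚ m) xs)))
    lemma₃ : ∀ m s → (1ℚ + m) * s + ℚ.- 1ℚ * s ≡ s * m
    lemma₃ = solve-∀ ℚ-ring
    bound : Σ[ xs ] u * Sm + ℚ.- 1ℚ * S⁺ ≤ S⁺ * ℕ→ℚ m
    bound = ≤-trans (ℚP.+-monoˡ-≤ (ℚ.- 1ℚ * S⁺) (chebyshev-sum m xs))
      (≤-reflexive (trans
        (cong (λ z → z * S⁺ + ℚ.- 1ℚ * S⁺) (trans (cong ℕ→ℚ len) (ℕ→ℚ-suc m)))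
        (lemma₃ (ℕ→ℚ m) S⁺)))

-- Tool for the strict form of Chebyshev's inequality: one strict term makes the sums strict, and
-- otherwise the left sum vanishes. The bound `0ℚ ≤ Σ[ xs ] g` is carried along for the induction.
Σ-<-or-zero : ∀ {f g : A → ℚ} xs → (∀ x → (f x ≡ 0ℚ × 0ℚ ≤ g x) ⊎ f x < g x) →
  (Σ[ xs ] f ≡ 0ℚ × 0ℚ ≤ Σ[ xs ] g) ⊎ Σ[ xs ] f < Σ[ xs ] g
Σ-<-or-zero []       h = inj₁ (refl , ≤-refl)
Σ-<-or-zero (x ∷ xs) h with h x | Σ-<-or-zero xs h
... | inj₁ (p , q) | inj₁ (r , s) = inj₁ (trans (cong₂ _+_ p r) (ℚP.+-identityˡ 0ℚ) , +-nonneg q s)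
... | inj₁ (p , q) | inj₂ s       = inj₂ (ℚP.+-mono-≤-< (subst₂ _≤_ (sym p) refl q) s)
... | inj₂ q       | inj₁ (r , s) = inj₂ (ℚP.+-mono-<-≤ q (subst₂ _≤_ (sym r) refl s))
... | inj₂ q       | inj₂ s       = inj₂ (ℚP.+-mono-< q s)

module Chebyshev {B : Set} (Ω : List B) (p : B → ℚ) (0≤p : ∀ x → 0ℚ ≤ p x)
  (Σp≡1 : Σ[ Ω ] p ≡ 1ℚ) (f : B → ℚ) (μ : ℚ) (mean : Σ[ Ω ] (λ x → p x * f x) ≡ μ)
  where

  dev : B → ℚ
  dev x = f x - μ

  variance : ℚ
  variance = Σ[ Ω ] (λ x → p x * (dev x * dev x))

  Σ-p*dev : Σ[ Ω ] (λ x → p x * dev x) ≡ 0ℚ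
  Σ-p*dev = trans (Σ-cong Ω (λ x _ → lemma₁ (p x) (f x) μ))
    (trans (Σ-+ (λ x → p x * f x) (λ x → ℚ.- μ * p x) Ω)
    (trans (cong₂ _+_ mean (trans (Σ-*ˡ (ℚ.- μ) p Ω) (cong (ℚ.- μ *_) Σp≡1))) (lemma₂ μ)))
    where
    lemma₁ : ∀ p f μ → p * (f - μ) ≡ p * f + ℚ.- μ * p
    lemma₁ = solve-∀ ℚ-ring
    lemma₂ : ∀ μ → μ + ℚ.- μ * 1ℚ ≡ 0ℚ
    lemma₂ = solve-∀ ℚ-ring

  -- The second moment is `variance + μ * μ`; the mixed term disappears by `Σ-p*dev`.
  variance≤ : variance ≤ Σ[ Ω ] (λ x → p x * (f x * f x))
  variance≤ = ≤-trans (p≤p+q (square-nonneg μ)) (≤-reflexive (sym (begin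
    Σ[ Ω ] (λ x → p x * (f x * f x))
      ≡⟨ Σ-cong Ω (λ x _ → lemma₁ (p x) (f x) μ) ⟩
    Σ[ Ω ] (λ x → p x * (dev x * dev x) + ((μ + μ) * (p x * dev x) + μ * μ * p x))
      ≡⟨ Σ-+ (λ x → p x * (dev x * dev x)) (λ x → (μ + μ) * (p x * dev x) + μ * μ * p x) Ω ⟩
    variance + Σ[ Ω ] (λ x → (μ + μ) * (p x * dev x) + μ * μ * p x)
      ≡⟨ cong (variance +_) (Σ-+ (λ x → (μ + μ) * (p x * dev x)) (λ x → μ * μ * p x) Ω) ⟩
    variance + (Σ[ Ω ] (λ x → (μ + μ) * (p x * dev x)) + Σ[ Ω ] (λ x → μ * μ * p x))
      ≡⟨ cong (variance +_) (cong₂ _+_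
           (trans (Σ-*ˡ (μ + μ) (λ x → p x * dev x) Ω) (cong ((μ + μ) *_) Σ-p*dev))
           (trans (Σ-*ˡ (μ * μ) p Ω) (cong (μ * μ *_) Σp≡1))) ⟩
    variance + ((μ + μ) * 0ℚ + μ * μ * 1ℚ)
      ≡⟨ lemma₂ variance μ ⟩
    variance + μ * μ ∎)))
    where
    open ≡-Reasoning
    lemma₁ : ∀ p f μ → p * (f * f) ≡
      p * ((f - μ) * (f - μ)) + ((μ + μ) * (p * (f - μ)) + μ * μ * p)
    lemma₁ = solve-∀ ℚ-ring
    lemma₂ : ∀ v μ → v + ((μ + μ) * 0ℚ + μ * μ * 1ℚ) ≡ v + μ * μ
    lemma₂ = solve-∀ ℚ-ring

  weight : List B → ℚ
  weight s = Π[ s ] p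

  -- The deviation of the sample mean multiplied by the number of samples: undivided, it is additive
  -- in the samples.
  sampleDev : ℕ → List B → ℚ
  sampleDev m s = Σ[ s ] f - ℕ→ℚ m * μ

  sampleDev-∷ : ∀ m x s → sampleDev (suc m) (x ∷ s) ≡ dev x + sampleDev m s
  sampleDev-∷ m x s = trans (cong (λ z → f x + Σ[ s ] f - z * μ) (ℕ→ℚ-suc m))
    (lemma (f x) (Σ[ s ] f) (ℕ→ℚ m) μ)
    where
    lemma : ∀ f s m μ → f + s - (1ℚ + m) * μ ≡ f - μ + (s - m * μ)
    lemma = solve-∀ ℚ-ring

  total-weight : ∀ m → Σ[ seqs m Ω ] weight ≡ 1ℚ
  total-weight zero    = ℚP.+-identityʳ 1ℚ
  total-weight (suc m) = trans (Σ-seqs weight m Ω) (trans (Σ-Σ-* p weight Ω (seqs m Ω))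
    (trans (cong₂ _*_ Σp≡1 (total-weight m)) (ℚP.*-identityˡ 1ℚ)))

  sample-mean : ∀ m → Σ[ seqs m Ω ] (λ s → weight s * sampleDev m s) ≡ 0ℚ
  sample-mean zero = lemma μ
    where
    lemma : ∀ μ → 1ℚ * (0ℚ - 0ℚ * μ) + 0ℚ ≡ 0ℚ
    lemma = solve-∀ ℚ-ring
  sample-mean (suc m) = begin
    Σ[ seqs (suc m) Ω ] (λ s → weight s * sampleDev (suc m) s)
      ≡⟨ Σ-seqs (λ s → weight s * sampleDev (suc m) s) m Ω ⟩
    Σ[ Ω ] (λ x → Σ[ seqs m Ω ] (λ s → p x * weight s * sampleDev (suc m) (x ∷ s)))
      ≡⟨ Σ-cong Ω (λ x _ → Σ-cong (seqs m Ω) (λ s _ → trans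
           (cong (p x * weight s *_) (sampleDev-∷ m x s))
           (lemma₁ (p x) (weight s) (dev x) (sampleDev m s)))) ⟩
    Σ[ Ω ] (λ x → Σ[ seqs m Ω ] (λ s → p x * dev x * weight s + p x * (weight s * sampleDev m s)))
      ≡⟨ Σ-Σ-+ (λ x s → p x * dev x * weight s) (λ x s → p x * (weight s * sampleDev m s)) Ω (seqs m Ω) ⟩
    Σ[ Ω ] (λ x → Σ[ seqs m Ω ] (λ s → p x * dev x * weight s))
      + Σ[ Ω ] (λ x → Σ[ seqs m Ω ] (λ s → p x * (weight s * sampleDev m s)))
      ≡⟨ cong₂ _+_ (Σ-Σ-* (λ x → p x * dev x) weight Ω (seqs m Ω))
           (Σ-Σ-* p (λ s → weight s * sampleDev m s) Ω (seqs m Ω)) ⟩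
    Σ[ Ω ] (λ x → p x * dev x) * Σ[ seqs m Ω ] weight
      + Σ[ Ω ] p * Σ[ seqs m Ω ] (λ s → weight s * sampleDev m s)
      ≡⟨ cong₂ _+_ (cong₂ _*_ Σ-p*dev (total-weight m)) (cong₂ _*_ Σp≡1 (sample-mean m)) ⟩
    0ℚ ∎
    where
    open ≡-Reasoning
    lemma₁ : ∀ p w d D → p * w * (d + D) ≡ p * d * w + p * (w * D)
    lemma₁ = solve-∀ ℚ-ring

  -- Independence is the product form of `weight`: after the first sample is split off, the mixed
  -- term of the square factors, and one factor is zero by `sample-mean`.
  sample-variance : ∀ m →
    Σ[ seqs m Ω ] (λ s → weight s * (sampleDev m s * sampleDev m s)) ≡ ℕ→ℚ m * variance
  sample-variance zero = lemma μ variance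
    where
    lemma : ∀ μ v → 1ℚ * ((0ℚ - 0ℚ * μ) * (0ℚ - 0ℚ * μ)) + 0ℚ ≡ 0ℚ * v
    lemma = solve-∀ ℚ-ring
  sample-variance (suc m) = begin
    Σ[ seqs (suc m) Ω ] (λ s → weight s * (D′ s * D′ s))
      ≡⟨ Σ-seqs (λ s → weight s * (D′ s * D′ s)) m Ω ⟩
    Σ[ Ω ] (λ x → Σ[ seqs m Ω ] (λ s → p x * weight s * (D′ (x ∷ s) * D′ (x ∷ s))))
      ≡⟨ Σ-cong Ω (λ x _ → Σ-cong (seqs m Ω) (λ s _ → trans
           (cong (λ z → p x * weight s * (z * z)) (sampleDev-∷ m x s))
           (lemma₁ (p x) (weight s) (dev x) (D s)))) ⟩
    Σ[ Ω ] (λ x → Σ[ seqs m Ω ] (λ s → F x s + (G x s + K x s)))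
      ≡⟨ trans (Σ-Σ-+ F (λ x s → G x s + K x s) Ω (seqs m Ω))
           (cong (Σ[ Ω ] (λ x → Σ[ seqs m Ω ] (F x)) +_) (Σ-Σ-+ G K Ω (seqs m Ω))) ⟩
    Σ[ Ω ] (λ x → Σ[ seqs m Ω ] (F x))
      + (Σ[ Ω ] (λ x → Σ[ seqs m Ω ] (G x)) + Σ[ Ω ] (λ x → Σ[ seqs m Ω ] (K x)))
      ≡⟨ cong₂ _+_ (Σ-Σ-* (λ x → p x * (dev x * dev x)) weight Ω (seqs m Ω))
         (cong₂ _+_ (Σ-Σ-* (λ x → (1ℚ + 1ℚ) * (p x * dev x)) (λ s → weight s * D s) Ω (seqs m Ω))
           (Σ-Σ-* p (λ s → weight s * (D s * D s)) Ω (seqs m Ω))) ⟩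
    variance * Σ[ seqs m Ω ] weight
      + (Σ[ Ω ] (λ x → (1ℚ + 1ℚ) * (p x * dev x)) * Σ[ seqs m Ω ] (λ s → weight s * D s)
        + Σ[ Ω ] p * Σ[ seqs m Ω ] (λ s → weight s * (D s * D s)))
      ≡⟨ cong₂ _+_ (cong (variance *_) (total-weight m))
         (cong₂ _+_ (cong (Σ[ Ω ] (λ x → (1ℚ + 1ℚ) * (p x * dev x)) *_) (sample-mean m))
           (cong₂ _*_ Σp≡1 (sample-variance m))) ⟩
    variance * 1ℚ + (Σ[ Ω ] (λ x → (1ℚ + 1ℚ) * (p x * dev x)) * 0ℚ + 1ℚ * (ℕ→ℚ m * variance))
      ≡⟨ lemma₂ variance (Σ[ Ω ] (λ x → (1ℚ + 1ℚ) * (p x * dev x))) (ℕ→ℚ m) ⟩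
    (1ℚ + ℕ→ℚ m) * variance
      ≡⟨ cong (_* variance) (sym (ℕ→ℚ-suc m)) ⟩
    ℕ→ℚ (suc m) * variance ∎
    where
    open ≡-Reasoning
    D  = sampleDev m
    D′ = sampleDev (suc m)
    F G K : B → List B → ℚ
    F x s = p x * (dev x * dev x) * weight s
    G x s = (1ℚ + 1ℚ) * (p x * dev x) * (weight s * D s)
    K x s = p x * (weight s * (D s * D s))
    lemma₁ : ∀ p w d D → p * w * ((d + D) * (d + D)) ≡
      p * (d * d) * w + ((1ℚ + 1ℚ) * (p * d) * (w * D) + p * (w * (D * D)))
    lemma₁ = solve-∀ ℚ-ring
    lemma₂ : ∀ v z m → v * 1ℚ + (z * 0ℚ + 1ℚ * (m * v)) ≡ (1ℚ + m) * v
    lemma₂ = solve-∀ ℚ-ring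

  -- The mean `Y` of the squared deviation is the variance divided by `N`, hence at most
  -- `η * (ε * ε)` by the choice of `N`; on the tail the squared deviation exceeds `ε * ε`. The
  -- parameter `v` stands for a known upper bound of the second moment.
  tail-bound : ∀ {ε η v} n → 0ℚ < ε → 0ℚ < η → Σ[ Ω ] (λ x → p x * (f x * f x)) ≤ v →
    (1ℚ /ₜ (η * (ε * ε))) * v ≤ ℕ→ℚ (suc n) →
    Σ[ seqs (suc n) Ω ] (λ s →
      if ⌊ ε ℚP.<? ∣ (Σ[ s ] f /ₜ ℕ→ℚ (suc n)) - μ ∣ ⌋ then Π[ s ] p else 0ℚ) < η
  tail-bound {ε} {η} {v} n 0<ε 0<η Σpf²≤v v≤N = *-cancelʳ-< (ℚP.<⇒≤ 0<ε²) (scaled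
    (Σ-<-or-zero {f = λ s → tail s * (ε * ε)} {g = λ s → weight s * (X s * X s)} (seqs (suc n) Ω) compare))
    where
    N = ℕ→ℚ (suc n)
    0<N = ℕ→ℚ-pos n
    0<ε² = *-pos 0<ε 0<ε
    0<c = *-pos 0<η 0<ε²
    X tail : List B → ℚ
    X s = (Σ[ s ] f /ₜ N) - μ
    tail s = if ⌊ ε ℚP.<? ∣ X s ∣ ⌋ then weight s else 0ℚ
    0≤weight : ∀ s → 0ℚ ≤ weight s
    0≤weight s = Π-nonneg s 0≤p

    compare : ∀ s → (tail s * (ε * ε) ≡ 0ℚ × 0ℚ ≤ weight s * (X s * X s))
      ⊎ tail s * (ε * ε) < weight s * (X s * X s)
    compare s with ε ℚP.<? ∣ X s ∣
    ... | no _ = inj₁ (ℚP.*-zeroˡ (ε * ε) , *-nonneg (0≤weight s) (square-nonneg (X s)))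
    ... | yes ε<∣X∣ with weight s ℚP.≟ 0ℚ
    -- A tail sample of weight zero gives no strict inequality, so it goes to the vanishing
    -- alternative.
    ...   | yes w≡0 = inj₁ (trans (cong (_* (ε * ε)) w≡0) (ℚP.*-zeroˡ (ε * ε))
                          , *-nonneg (0≤weight s) (square-nonneg (X s)))
    ...   | no  w≢0 = inj₂ (*-monoˡ-< (nonneg∧≢0⇒pos (0≤weight s) w≢0) (<∣∣⇒square< 0<ε ε<∣X∣))

    XN≡sampleDev : ∀ s → X s * N ≡ sampleDev (suc n) s
    XN≡sampleDev s = trans (lemma (Σ[ s ] f /ₜ N) μ N)
      (cong (λ z → z - N * μ) (/ₜ-*-cancel (Σ[ s ] f) (pos⇒≢0 0<N)))
      where
      lemma : ∀ a μ N → (a - μ) * N ≡ a * N - N * μ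
      lemma = solve-∀ ℚ-ring

    Y = Σ[ seqs (suc n) Ω ] (λ s → weight s * (X s * X s))

    YN²≡ : Y * N * N ≡ variance * N
    YN²≡ = begin
      Y * N * N ≡⟨ ℚP.*-assoc Y N N ⟩
      Y * (N * N) ≡⟨ Σ-*ʳ (N * N) (λ s → weight s * (X s * X s)) (seqs (suc n) Ω) ⟨
      Σ[ seqs (suc n) Ω ] (λ s → weight s * (X s * X s) * (N * N))
        ≡⟨ Σ-cong (seqs (suc n) Ω) (λ s _ → trans (lemma (weight s) (X s) N)
             (cong (λ z → weight s * (z * z)) (XN≡sampleDev s))) ⟩
      Σ[ seqs (suc n) Ω ] (λ s → weight s * (sampleDev (suc n) s * sampleDev (suc n) s))
        ≡⟨ sample-variance (suc n) ⟩
      N * variance ≡⟨ ℚP.*-comm N variance ⟩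
      variance * N ∎
      where
      open ≡-Reasoning
      lemma : ∀ w x N → w * (x * x) * (N * N) ≡ w * (x * N * (x * N))
      lemma = solve-∀ ℚ-ring

    Y≤c : Y ≤ η * (ε * ε)
    -- One factor `N` is cancelled to obtain `Y * N ≤ variance`, the other after the sample bound
    -- has given `v ≤ η * (ε * ε) * N`.
    Y≤c = *-cancelʳ-≤ 0<N (≤-trans (*-cancelʳ-≤ 0<N (≤-reflexive YN²≡))
      (≤-trans variance≤ (≤-trans Σpf²≤v (1/ₜ-*-≤ 0<c v≤N))))

    scaled : (Σ[ seqs (suc n) Ω ] (λ s → tail s * (ε * ε)) ≡ 0ℚ × 0ℚ ≤ Y)
        ⊎ Σ[ seqs (suc n) Ω ] (λ s → tail s * (ε * ε)) < Y →
      Σ[ seqs (suc n) Ω ] tail * (ε * ε) < η * (ε * ε)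
    scaled r = subst (_< η * (ε * ε)) (Σ-*ʳ (ε * ε) tail (seqs (suc n) Ω)) (below r)
      where
      below : (Σ[ seqs (suc n) Ω ] (λ s → tail s * (ε * ε)) ≡ 0ℚ × 0ℚ ≤ Y)
          ⊎ Σ[ seqs (suc n) Ω ] (λ s → tail s * (ε * ε)) < Y →
        Σ[ seqs (suc n) Ω ] (λ s → tail s * (ε * ε)) < η * (ε * ε)
      below (inj₁ (≡0 , _)) = subst (_< η * (ε * ε)) (sym ≡0) 0<c
      below (inj₂ <Y)       = ℚP.<-≤-trans <Y Y≤c

-- Walks and powers of a kernel

length-seqs : ∀ m (xs : List A) {s} → s ∈ seqs m xs → length s ≡ m
length-seqs zero    xs (here refl) = refl
length-seqs (suc m) xs s∈ with find (∈-concatMap⁻ (λ x → map (x ∷_) (seqs m xs)) {xs = xs} s∈)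
... | x , _ , s∈′ with ∈-map⁻ (x ∷_) s∈′
...   | t , t∈ , refl = cong suc (length-seqs m xs t∈)

length-steps : ∀ (x : A) s → length (steps (x ∷ s)) ≡ length s
length-steps x []      = refl
length-steps x (y ∷ s) = cong suc (length-steps y s)

module Kernel {A : Set} (xs : List A) where

  -- The kernel acts on functions, so iterates compose as in `power-+`; matrix entries appear when
  -- `h` is an indicator, as in `entry`.
  power : (A → A → ℚ) → ℕ → (A → ℚ) → A → ℚ
  power k zero    h x = h x
  power k (suc m) h x = Σ[ xs ] (λ y → k x y * power k m h y)

  weight : (A → A → ℚ) → List A → ℚ
  weight k s = Π[ steps s ] (uncurry k)

  -- The default `d` is never returned, as `x ∷ s` is nonempty. It is separate from `x` because the
  -- start of the walk moves in the induction while the default stays.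
  Σ-paths≡power : ∀ k h d m x →
    Σ[ seqs m xs ] (λ s → weight k (x ∷ s) * h (lastOr d (x ∷ s))) ≡ power k m h x
  Σ-paths≡power k h d zero x = lemma (h x)
    where
    lemma : ∀ a → 1ℚ * a + 0ℚ ≡ a
    lemma = solve-∀ ℚ-ring
  Σ-paths≡power k h d (suc m) x = trans
    (Σ-seqs (λ s → weight k (x ∷ s) * h (lastOr d (x ∷ s))) m xs) (Σ-cong xs (λ y _ →
    trans (Σ-cong (seqs m xs) (λ s _ →
            ℚP.*-assoc (k x y) (weight k (y ∷ s)) (h (lastOr d (y ∷ s)))))
      (trans (Σ-*ˡ (k x y) (λ s → weight k (y ∷ s) * h (lastOr d (y ∷ s))) (seqs m xs))
             (cong (k x y *_) (Σ-paths≡power k h d m y)))))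

  power-cong : ∀ {k k′ h} → (∀ x y → x ∈ xs → y ∈ xs → k x y ≡ k′ x y) →
    ∀ m x → x ∈ xs → power k m h x ≡ power k′ m h x
  power-cong eq zero    x x∈ = refl
  power-cong eq (suc m) x x∈ =
    Σ-cong xs (λ y y∈ → cong₂ _*_ (eq x y x∈ y∈) (power-cong eq m y y∈))

  power-nonneg : ∀ {k h} → (∀ x y → 0ℚ ≤ k x y) → (∀ x → 0ℚ ≤ h x) → ∀ m x → 0ℚ ≤ power k m h x
  power-nonneg 0≤k 0≤h zero    x = 0≤h x
  power-nonneg 0≤k 0≤h (suc m) x =
    Σ-nonneg xs (λ y _ → *-nonneg (0≤k x y) (power-nonneg 0≤k 0≤h m y))

  power-+ : ∀ k h i j x → power k (i ℕ.+ j) h x ≡ power k i (power k j h) x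
  power-+ k h zero    j x = refl
  power-+ k h (suc i) j x = Σ-cong xs (λ y _ → cong (k x y *_) (power-+ k h i j y))

  power≤1 : ∀ {k h} → (∀ x y → 0ℚ ≤ k x y) → (∀ x → x ∈ xs → Σ[ xs ] (k x) ≡ 1ℚ) →
    (∀ x → h x ≤ 1ℚ) → ∀ m x → x ∈ xs → power k m h x ≤ 1ℚ
  power≤1 0≤k Σk≡1 h≤1 zero    x x∈ = h≤1 x
  power≤1 {k} 0≤k Σk≡1 h≤1 (suc m) x x∈ = ≤-trans
    (Σ-mono xs (λ y y∈ → ≤-trans (*-monoˡ-≤ (0≤k x y) (power≤1 0≤k Σk≡1 h≤1 m y y∈))
                                 (≤-reflexive (ℚP.*-identityʳ (k x y)))))
    (≤-reflexive (Σk≡1 x x∈))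

  total-weight : ∀ {k} → (∀ x → x ∈ xs → Σ[ xs ] (k x) ≡ 1ℚ) →
    ∀ m x → x ∈ xs → Σ[ seqs m xs ] (λ s → weight k (x ∷ s)) ≡ 1ℚ
  total-weight Σk≡1 zero    x x∈ = ℚP.+-identityʳ 1ℚ
  total-weight {k} Σk≡1 (suc m) x x∈ = trans (Σ-seqs (λ s → weight k (x ∷ s)) m xs)
    (trans (Σ-cong xs (λ y y∈ → trans (Σ-*ˡ (k x y) (λ s → weight k (y ∷ s)) (seqs m xs))
             (trans (cong (k x y *_) (total-weight {k} Σk≡1 m y y∈)) (ℚP.*-identityʳ (k x y)))))
           (Σk≡1 x x∈))

  module _ (δ : A → A → ℚ) (δ-sym : ∀ x y → δ x y ≡ δ y x)
    (Σ-δ : ∀ x → x ∈ xs → (g : A → ℚ) → Σ[ xs ] (λ y → δ x y * g y) ≡ g x) where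

    entry : (A → A → ℚ) → ℕ → A → A → ℚ
    entry k m x y = power k m (λ z → δ z y) x

    power≡Σ-entry : ∀ k h m x → x ∈ xs → power k m h x ≡ Σ[ xs ] (λ y → entry k m x y * h y)
    power≡Σ-entry k h zero    x x∈ = sym (Σ-δ x x∈ h)
    power≡Σ-entry k h (suc m) x x∈ = begin
      Σ[ xs ] (λ z → k x z * power k m h z)
        ≡⟨ Σ-cong xs (λ z z∈ → trans (cong (k x z *_) (power≡Σ-entry k h m z z∈))
             (trans (sym (Σ-*ˡ (k x z) (λ y → entry k m z y * h y) xs))
               (Σ-cong xs (λ y _ → sym (ℚP.*-assoc (k x z) (entry k m z y) (h y)))))) ⟩
      Σ[ xs ] (λ z → Σ[ xs ] (λ y → k x z * entry k m z y * h y))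
        ≡⟨ Σ-swap (λ z y → k x z * entry k m z y * h y) xs xs ⟩
      Σ[ xs ] (λ y → Σ[ xs ] (λ z → k x z * entry k m z y * h y))
        ≡⟨ Σ-cong xs (λ y _ → Σ-*ʳ (h y) (λ z → k x z * entry k m z y) xs) ⟩
      Σ[ xs ] (λ y → entry k (suc m) x y * h y) ∎
      where open ≡-Reasoning

    entry-+ : ∀ k i j x z → x ∈ xs →
      entry k (i ℕ.+ j) x z ≡ Σ[ xs ] (λ y → entry k i x y * entry k j y z)
    entry-+ k i j x z x∈ = trans (power-+ k (λ y → δ y z) i j x)
      (power≡Σ-entry k (power k j (λ y → δ y z)) i x x∈)

    entry-1 : ∀ k x z → z ∈ xs → entry k 1 x z ≡ k x z
    entry-1 k x z z∈ = trans
      (Σ-cong xs (λ y _ → trans (cong (k x y *_) (δ-sym y z)) (ℚP.*-comm (k x y) (δ z y))))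
      (Σ-δ z z∈ (k x))

    -- `power` splits off the first step; the rotation of closed walks appends steps at the end.
    entry-suc : ∀ k j y z → y ∈ xs → z ∈ xs →
      entry k (suc j) y z ≡ Σ[ xs ] (λ x → entry k j y x * k x z)
    entry-suc k j y z y∈ z∈ = trans (cong (λ i → entry k i y z) (ℕP.+-comm 1 j))
      (trans (entry-+ k j 1 y z y∈)
             (Σ-cong xs (λ x _ → cong (entry k j y x *_) (entry-1 k x z z∈))))

    diagonal-power : ∀ {k} → (∀ x y → 0ℚ ≤ k x y) → (∀ x y → 0ℚ ≤ δ x y) → (∀ x → δ x x ≡ 1ℚ) →
      ∀ m x → x ∈ xs → k x x ^ℚ m ≤ entry k m x x
    diagonal-power 0≤k 0≤δ δxx zero    x x∈ = ≤-reflexive (sym (δxx x))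
    diagonal-power 0≤k 0≤δ δxx (suc m) x x∈ = ≤-trans
      (*-monoˡ-≤ (0≤k x x) (diagonal-power 0≤k 0≤δ δxx m x x∈))
      (∈⇒≤Σ xs (λ y → *-nonneg (0≤k x y) (power-nonneg 0≤k (λ z → 0≤δ z x) m y)) x∈)

    module _ (k : A → A → ℚ) (w : A → ℚ) where

      -- `w` is read at the source of each step, so the base point of a nontrivial closed walk is
      -- not counted again on return.
      visits : List A → ℚ
      visits s = Σ[ steps s ] (w ∘ proj₁)

      visitSum : ℕ → A → A → ℚ
      visitSum m x y =
        Σ[ seqs m xs ] (λ s → weight k (x ∷ s) * visits (x ∷ s) * δ (lastOr y (x ∷ s)) y)

      -- The visit to `x` factors out and leaves a plain matrix entry; all later visits belong to
      -- the walk from `z`.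
      visitSum-suc : ∀ m x y → visitSum (suc m) x y ≡
        w x * entry k (suc m) x y + Σ[ xs ] (λ z → k x z * visitSum m z y)
      visitSum-suc m x y = trans
        (Σ-seqs (λ s → weight k (x ∷ s) * visits (x ∷ s) * δ (lastOr y (x ∷ s)) y) m xs) (trans
        (trans (Σ-cong xs (λ z _ → Σ-cong (seqs m xs) (λ s _ →
            lemma (k x z) (weight k (z ∷ s)) (w x) (visits (z ∷ s)) (δ (lastOr y (z ∷ s)) y))))
          (Σ-Σ-+ (λ z s → w x * (k x z * (weight k (z ∷ s) * δ (lastOr y (z ∷ s)) y)))
            (λ z s → k x z * (weight k (z ∷ s) * visits (z ∷ s) * δ (lastOr y (z ∷ s)) y))
            xs (seqs m xs)))
        (cong₂ _+_
          (trans (Σ-cong xs (λ z _ →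
              trans (Σ-*ˡ (w x) (λ s → k x z * (weight k (z ∷ s) * δ (lastOr y (z ∷ s)) y)) (seqs m xs))
                (cong (w x *_) (trans
                  (Σ-*ˡ (k x z) (λ s → weight k (z ∷ s) * δ (lastOr y (z ∷ s)) y) (seqs m xs))
                  (cong (k x z *_) (Σ-paths≡power k (λ v → δ v y) y m z))))))
            (Σ-*ˡ (w x) (λ z → k x z * entry k m z y) xs))
          (Σ-cong xs (λ z _ → Σ-*ˡ (k x z)
            (λ s → weight k (z ∷ s) * visits (z ∷ s) * δ (lastOr y (z ∷ s)) y) (seqs m xs)))))
        where
        lemma : ∀ k p w v d → k * p * (w + v) * d ≡ w * (k * (p * d)) + k * (p * v * d)
        lemma = solve-∀ ℚ-ring

      -- A closed walk may be started at any of its vertices; for the induction, j further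
      -- steps of the walk are collected in entry k j.
      Σ-visitSum : ∀ m j → Σ[ xs ] (λ x → Σ[ xs ] (λ y → entry k j y x * visitSum m x y))
        ≡ ℕ→ℚ m * Σ[ xs ] (λ x → w x * entry k (m ℕ.+ j) x x)
      Σ-visitSum zero j = trans
        (trans (Σ-cong xs (λ x _ → trans
            (Σ-cong xs (λ y _ → lemma (entry k j y x) (δ (lastOr y (x ∷ [])) y)))
            (Σ-zero xs)))
          (Σ-zero xs))
        (sym (ℚP.*-zeroˡ (Σ[ xs ] (λ x → w x * entry k j x x))))
        where
        lemma : ∀ e d → e * (1ℚ * 0ℚ * d + 0ℚ) ≡ 0ℚ
        lemma = solve-∀ ℚ-ring
      Σ-visitSum (suc m) j = begin
        Σ[ xs ] (λ x → Σ[ xs ] (λ y → entry k j y x * visitSum (suc m) x y))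
          ≡⟨ Σ-cong xs (λ x _ → Σ-cong xs (λ y _ → trans
               (cong (entry k j y x *_) (visitSum-suc m x y))
               (ℚP.*-distribˡ-+ (entry k j y x) (w x * entry k (suc m) x y)
                 (Σ[ xs ] (λ z → k x z * visitSum m z y))))) ⟩
        Σ[ xs ] (λ x → Σ[ xs ] (λ y → first x y + rest x y))
          ≡⟨ Σ-Σ-+ first rest xs xs ⟩
        Σ[ xs ] (λ x → Σ[ xs ] (first x)) + Σ[ xs ] (λ x → Σ[ xs ] (rest x))
          ≡⟨ cong₂ _+_ Σ-first Σ-rest ⟩
        W + ℕ→ℚ m * W
          ≡⟨ lemma₀ (ℕ→ℚ m) W ⟩
        (1ℚ + ℕ→ℚ m) * W
          ≡⟨ cong (_* W) (ℕ→ℚ-suc m) ⟨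
        ℕ→ℚ (suc m) * W ∎
        where
        open ≡-Reasoning
        W = Σ[ xs ] (λ x → w x * entry k (suc m ℕ.+ j) x x)
        first rest : A → A → ℚ
        first x y = entry k j y x * (w x * entry k (suc m) x y)
        rest x y = entry k j y x * Σ[ xs ] (λ z → k x z * visitSum m z y)
        lemma₀ : ∀ m w → w + m * w ≡ (1ℚ + m) * w
        lemma₀ = solve-∀ ℚ-ring
        lemma₁ : ∀ a w b → a * (w * b) ≡ w * (b * a)
        lemma₁ = solve-∀ ℚ-ring
        Σ-first : Σ[ xs ] (λ x → Σ[ xs ] (first x)) ≡ W
        Σ-first = Σ-cong xs (λ x x∈ → trans
          (Σ-cong xs (λ y _ → lemma₁ (entry k j y x) (w x) (entry k (suc m) x y)))
          (trans (Σ-*ˡ (w x) (λ y → entry k (suc m) x y * entry k j y x) xs)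
                 (cong (w x *_) (sym (entry-+ k (suc m) j x x x∈)))))
        -- The step from `x` to `z` is moved from the front of the walk to the end of the collected
        -- arc: summed over `x`, it turns `entry k j y x` into `entry k (suc j) y z`.
        Σ-rest : Σ[ xs ] (λ x → Σ[ xs ] (rest x)) ≡ ℕ→ℚ m * W
        Σ-rest = begin
          Σ[ xs ] (λ x → Σ[ xs ] (rest x))
            ≡⟨ Σ-swap rest xs xs ⟩
          Σ[ xs ] (λ y → Σ[ xs ] (λ x → rest x y))
            ≡⟨ Σ-cong xs (λ y y∈ → trans
                 (Σ-cong xs (λ x _ → trans
                   (sym (Σ-*ˡ (entry k j y x) (λ z → k x z * visitSum m z y) xs))
                   (Σ-cong xs (λ z _ → sym (ℚP.*-assoc (entry k j y x) (k x z) (visitSum m z y))))))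
                 (trans (Σ-swap (λ x z → entry k j y x * k x z * visitSum m z y) xs xs)
                   (Σ-cong xs (λ z z∈ → trans
                     (Σ-*ʳ (visitSum m z y) (λ x → entry k j y x * k x z) xs)
                     (cong (_* visitSum m z y) (sym (entry-suc k j y z y∈ z∈))))))) ⟩
          Σ[ xs ] (λ y → Σ[ xs ] (λ z → entry k (suc j) y z * visitSum m z y))
            ≡⟨ Σ-swap (λ y z → entry k (suc j) y z * visitSum m z y) xs xs ⟩
          Σ[ xs ] (λ z → Σ[ xs ] (λ y → entry k (suc j) y z * visitSum m z y))
            ≡⟨ Σ-visitSum m (suc j) ⟩
          ℕ→ℚ m * Σ[ xs ] (λ x → w x * entry k (m ℕ.+ suc j) x x)
            ≡⟨ cong (λ i → ℕ→ℚ m * Σ[ xs ] (λ x → w x * entry k i x x)) (ℕP.+-suc m j) ⟩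
          ℕ→ℚ m * W ∎

      Σ-visitSum-closed : ∀ m →
        Σ[ xs ] (λ x → visitSum m x x) ≡ ℕ→ℚ m * Σ[ xs ] (λ x → w x * entry k m x x)
      Σ-visitSum-closed m = trans
        (Σ-cong xs (λ x x∈ → sym (trans
          (Σ-cong xs (λ y _ → cong (_* visitSum m x y) (δ-sym y x)))
          (Σ-δ x x∈ (visitSum m x)))))
        (trans (Σ-visitSum m 0)
          (cong (λ i → ℕ→ℚ m * Σ[ xs ] (λ x → w x * entry k i x x)) (ℕP.+-identityʳ m)))

    closed-walks-≤ : ∀ {k u} → (∀ x y → 0ℚ ≤ k x y) → (∀ x → x ∈ xs → Σ[ xs ] (k x) ≡ 1ℚ) →
      (∀ x → 0ℚ ≤ u x) → (∀ x y → 0ℚ ≤ δ x y) → (∀ x y → δ x y ≤ 1ℚ) → ∀ m →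
      Σ[ xs ] (λ x → entry (λ y z → k y z * u y) (suc m) x x) ≤ Σ[ xs ] (λ x → u x ^ℚ suc m)
    closed-walks-≤ {k} {u} 0≤k Σk≡1 0≤u 0≤δ δ≤1 m = *-cancelʳ-≤ (ℕ→ℚ-pos m) (≤-trans
      (≤-trans (≤-reflexive scaled) (Σ-mono xs (λ x _ → Σ-mono (seqs ℓ xs) (λ s s∈ → step x s s∈))))
      (≤-trans (≤-reflexive (Σ-visitSum-closed k w ℓ))
        (≤-trans (*-monoˡ-≤ (ℕ→ℚ-nonneg ℓ) (Σ-mono xs (λ x x∈ → ≤-trans
            (*-monoˡ-≤ (^-nonneg ℓ (0≤u x)) (power≤1 0≤k Σk≡1 (λ z → δ≤1 z x) ℓ x x∈))
            (≤-reflexive (ℚP.*-identityʳ (w x))))))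
          (≤-reflexive (ℚP.*-comm (ℕ→ℚ ℓ) (Σ[ xs ] w))))))
      where
      ℓ = suc m
      w : A → ℚ
      w x = u x ^ℚ ℓ
      ku : A → A → ℚ
      ku y z = k y z * u y
      scaled : Σ[ xs ] (λ x → entry ku ℓ x x) * ℕ→ℚ ℓ ≡
        Σ[ xs ] (λ x → Σ[ seqs ℓ xs ] (λ s → weight ku (x ∷ s) * δ (lastOr x (x ∷ s)) x * ℕ→ℚ ℓ))
      scaled = trans (sym (Σ-*ʳ (ℕ→ℚ ℓ) (λ x → entry ku ℓ x x) xs)) (Σ-cong xs (λ x _ →
        trans (cong (_* ℕ→ℚ ℓ) (sym (Σ-paths≡power ku (λ z → δ z x) x ℓ x)))
          (sym (Σ-*ʳ (ℕ→ℚ ℓ) (λ s → weight ku (x ∷ s) * δ (lastOr x (x ∷ s)) x) (seqs ℓ xs)))))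
      lemma : ∀ p u d n → p * u * d * n ≡ p * d * (n * u)
      lemma = solve-∀ ℚ-ring
      lemma′ : ∀ p d v → p * d * v ≡ p * v * d
      lemma′ = solve-∀ ℚ-ring
      step : ∀ x s → s ∈ seqs ℓ xs → weight ku (x ∷ s) * δ (lastOr x (x ∷ s)) x * ℕ→ℚ ℓ
        ≤ weight k (x ∷ s) * visits k w (x ∷ s) * δ (lastOr x (x ∷ s)) x
      step x s s∈ = subst₂ _≤_
        (sym (trans
          (cong (λ z → z * δ (lastOr x (x ∷ s)) x * ℕ→ℚ ℓ)
            (Π-* (uncurry k) (u ∘ proj₁) (steps (x ∷ s))))
          (lemma (weight k (x ∷ s)) (Π[ steps (x ∷ s) ] (u ∘ proj₁)) (δ (lastOr x (x ∷ s)) x) (ℕ→ℚ ℓ))))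
        (lemma′ (weight k (x ∷ s)) (δ (lastOr x (x ∷ s)) x) (visits k w (x ∷ s)))
        (*-monoˡ-≤
          (*-nonneg (Π-nonneg (steps (x ∷ s)) (λ e → 0≤k (proj₁ e) (proj₂ e))) (0≤δ _ x))
          (am-gm (u ∘ proj₁) (λ e → 0≤u (proj₁ e)) ℓ (steps (x ∷ s))
            (trans (length-steps x s) (length-seqs ℓ xs s∈))))

-- Facets and cofaces in a simplicial complex

δ-refl : ∀ (σ : Subset n) → δ σ σ ≡ 1ℚ
δ-refl []          = refl
δ-refl (true  ∷ σ) = δ-refl σ
δ-refl (false ∷ σ) = δ-refl σ

δ-≢ : ∀ (σ τ : Subset n) → σ ≢ τ → δ σ τ ≡ 0ℚ
δ-≢ []          []          σ≢τ = contradiction refl σ≢τ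
δ-≢ (true  ∷ σ) (true  ∷ τ) σ≢τ = δ-≢ σ τ (σ≢τ ∘ cong (true ∷_))
δ-≢ (true  ∷ σ) (false ∷ τ) σ≢τ = refl
δ-≢ (false ∷ σ) (true  ∷ τ) σ≢τ = refl
δ-≢ (false ∷ σ) (false ∷ τ) σ≢τ = δ-≢ σ τ (σ≢τ ∘ cong (false ∷_))

δ-sym : ∀ (σ τ : Subset n) → δ σ τ ≡ δ τ σ
δ-sym σ τ with VecP.≡-dec BoolP._≟_ σ τ
... | yes refl = refl
... | no  σ≢τ  = trans (δ-≢ σ τ σ≢τ) (sym (δ-≢ τ σ (σ≢τ ∘ sym)))

δ-nonneg : ∀ (σ τ : Subset n) → 0ℚ ≤ δ σ τ
δ-nonneg σ τ with σ ==ˢ τ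
... | true  = ℚP.nonNegative⁻¹ 1ℚ
... | false = ≤-refl

δ≤1 : ∀ (σ τ : Subset n) → δ σ τ ≤ 1ℚ
δ≤1 σ τ with σ ==ˢ τ
... | true  = ≤-refl
... | false = ℚP.nonNegative⁻¹ 1ℚ

Σ-δ : ∀ {xs : List (Subset n)} → Unique xs → ∀ σ → σ ∈ xs → ∀ (g : Subset n → ℚ) →
  Σ[ xs ] (λ τ → δ σ τ * g τ) ≡ g σ
Σ-δ {xs = σ ∷ xs} (σ∉ ∷ _) .σ (here refl) g = trans
  (cong₂ _+_ (trans (cong (_* g σ) (δ-refl σ)) (ℚP.*-identityˡ (g σ)))
    (trans (Σ-cong xs (λ τ τ∈ → trans
        (cong (_* g τ) (δ-≢ σ τ (All.lookup σ∉ τ∈))) (ℚP.*-zeroˡ (g τ))))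
      (Σ-zero xs)))
  (ℚP.+-identityʳ (g σ))
Σ-δ {xs = τ ∷ xs} (τ∉ ∷ u) σ (there σ∈) g = trans
  (cong₂ _+_
    (trans (cong (_* g τ) (δ-≢ σ τ (λ σ≡τ → All.lookup τ∉ σ∈ (sym σ≡τ)))) (ℚP.*-zeroˡ (g τ)))
    (Σ-δ u σ σ∈ g))
  (ℚP.+-identityˡ (g σ))

allSubsets-unique : ∀ n → Unique (allSubsets n)
allSubsets-unique zero    = All.[] ∷ []
allSubsets-unique (suc n) = UniqueP.++⁺
  (UniqueP.map⁺ VecP.∷-injectiveʳ (allSubsets-unique n))
  (UniqueP.map⁺ VecP.∷-injectiveʳ (allSubsets-unique n))
  disjoint
  where
  disjoint : ∀ {σ} → ¬ (σ ∈ map (false ∷_) (allSubsets n) × σ ∈ map (true ∷_) (allSubsets n))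
  disjoint (p , q) with ∈-map⁻ (false ∷_) p | ∈-map⁻ (true ∷_) q
  ... | _ , _ , refl | _ , _ , ()

S-unique : ∀ (Γ : SimplicialComplex n) k → Unique (S Γ k)
S-unique {n} Γ k = UniqueP.filter⁺ _ (allSubsets-unique n)

∈S⇒card : ∀ (Γ : SimplicialComplex n) k {σ} → σ ∈ S Γ k → card σ ≡ suc k
∈S⇒card {n} Γ k {σ} σ∈ = toWitness {a? = card σ ℕ.≟ suc k} (proj₂ (Equivalence.to (BoolP.T-∧ {mem Γ σ} {card σ ==ℕ suc k})
  (proj₂ (∈-filter⁻ _ {v = σ} {xs = allSubsets n} σ∈))))

Σ-allSubsets : ∀ (f : Subset (suc n) → ℚ) → Σ[ allSubsets (suc n) ] f ≡
  Σ[ allSubsets n ] (λ σ → f (false ∷ σ)) + Σ[ allSubsets n ] (λ σ → f (true ∷ σ))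
Σ-allSubsets {n} f = trans (Σ-++ f (map (false ∷_) (allSubsets n)) (map (true ∷_) (allSubsets n)))
  (cong₂ _+_ (Σ-map f (false ∷_) (allSubsets n)) (Σ-map f (true ∷_) (allSubsets n)))

Σ-allSubsets-δ : ∀ (σ : Subset n) → Σ[ allSubsets n ] (δ σ) ≡ 1ℚ
Σ-allSubsets-δ []                  = refl
Σ-allSubsets-δ {suc n} (true ∷ σ)  = trans (Σ-allSubsets (δ (true ∷ σ)))
  (trans (cong₂ _+_ (Σ-zero (allSubsets n)) (Σ-allSubsets-δ σ)) (ℚP.+-identityˡ 1ℚ))
Σ-allSubsets-δ {suc n} (false ∷ σ) = trans (Σ-allSubsets (δ (false ∷ σ)))
  (trans (cong₂ _+_ (Σ-allSubsets-δ σ) (Σ-zero (allSubsets n))) (ℚP.+-identityʳ 1ℚ))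

-- Indicator of σ being τ with one vertex added; the recursion follows faces', which makes
-- it the square of bd τ σ.
covers : Subset n → Subset n → ℚ
covers []          []          = 0ℚ
covers (false ∷ τ) (false ∷ σ) = covers τ σ
covers (true  ∷ τ) (false ∷ σ) = 0ℚ
covers (false ∷ τ) (true  ∷ σ) = δ σ τ
covers (true  ∷ τ) (true  ∷ σ) = covers τ σ

covers-nonneg : ∀ (τ σ : Subset n) → 0ℚ ≤ covers τ σ
covers-nonneg []          []          = ≤-refl
covers-nonneg (false ∷ τ) (false ∷ σ) = covers-nonneg τ σ
covers-nonneg (true  ∷ τ) (false ∷ σ) = ≤-refl
covers-nonneg (false ∷ τ) (true  ∷ σ) = δ-nonneg σ τ
covers-nonneg (true  ∷ τ) (true  ∷ σ) = covers-nonneg τ σ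

covers≤1 : ∀ (τ σ : Subset n) → covers τ σ ≤ 1ℚ
covers≤1 []          []          = ℚP.nonNegative⁻¹ 1ℚ
covers≤1 (false ∷ τ) (false ∷ σ) = covers≤1 τ σ
covers≤1 (true  ∷ τ) (false ∷ σ) = ℚP.nonNegative⁻¹ 1ℚ
covers≤1 (false ∷ τ) (true  ∷ σ) = δ≤1 σ τ
covers≤1 (true  ∷ τ) (true  ∷ σ) = covers≤1 τ σ

⊆ᵇ-refl : ∀ (σ : Subset n) → T (σ ⊆ᵇ σ)
⊆ᵇ-refl []          = _
⊆ᵇ-refl (true  ∷ σ) = ⊆ᵇ-refl σ
⊆ᵇ-refl (false ∷ σ) = ⊆ᵇ-refl σ

⊆ᵇ⇒card≤ : ∀ (τ σ : Subset n) → T (τ ⊆ᵇ σ) → card τ ℕ.≤ card σ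
⊆ᵇ⇒card≤ []          []          _ = ℕ.z≤n
⊆ᵇ⇒card≤ (false ∷ τ) (false ∷ σ) h = ⊆ᵇ⇒card≤ τ σ h
⊆ᵇ⇒card≤ (false ∷ τ) (true  ∷ σ) h = ℕP.m≤n⇒m≤1+n (⊆ᵇ⇒card≤ τ σ h)
⊆ᵇ⇒card≤ (true  ∷ τ) (true  ∷ σ) h = ℕ.s≤s (⊆ᵇ⇒card≤ τ σ h)

⊆ᵇ∧card≡⇒≡ : ∀ (τ σ : Subset n) → T (τ ⊆ᵇ σ) → card σ ≡ card τ → σ ≡ τ
⊆ᵇ∧card≡⇒≡ []          []          _ _  = refl
⊆ᵇ∧card≡⇒≡ (false ∷ τ) (false ∷ σ) h eq = cong (false ∷_) (⊆ᵇ∧card≡⇒≡ τ σ h eq)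
⊆ᵇ∧card≡⇒≡ (false ∷ τ) (true  ∷ σ) h eq =
  contradiction (⊆ᵇ⇒card≤ τ σ h) (ℕP.<⇒≱ (ℕP.≤-reflexive eq))
⊆ᵇ∧card≡⇒≡ (true  ∷ τ) (true  ∷ σ) h eq =
  cong (true ∷_) (⊆ᵇ∧card≡⇒≡ τ σ h (ℕP.suc-injective eq))

-- At the first vertex of `σ` missing from `τ` the sizes of the remainders agree, so inclusion
-- becomes equality there.
⊆ᵇ⇒covers : ∀ (τ σ : Subset n) → T (τ ⊆ᵇ σ) → card σ ≡ suc (card τ) → covers τ σ ≡ 1ℚ
⊆ᵇ⇒covers []          []          _ ()
⊆ᵇ⇒covers (false ∷ τ) (false ∷ σ) h eq = ⊆ᵇ⇒covers τ σ h eq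
⊆ᵇ⇒covers (false ∷ τ) (true  ∷ σ) h eq =
  trans (cong (λ ρ → δ ρ τ) (⊆ᵇ∧card≡⇒≡ τ σ h (ℕP.suc-injective eq))) (δ-refl τ)
⊆ᵇ⇒covers (true  ∷ τ) (true  ∷ σ) h eq = ⊆ᵇ⇒covers τ σ h (ℕP.suc-injective eq)

⊈ᵇ⇒covers : ∀ (τ σ : Subset n) → ¬ T (τ ⊆ᵇ σ) → covers τ σ ≡ 0ℚ
⊈ᵇ⇒covers []          []          _ = refl
⊈ᵇ⇒covers (false ∷ τ) (false ∷ σ) h = ⊈ᵇ⇒covers τ σ h
⊈ᵇ⇒covers (true  ∷ τ) (false ∷ σ) h = refl
⊈ᵇ⇒covers (false ∷ τ) (true  ∷ σ) h = δ-≢ σ τ (λ { refl → h (⊆ᵇ-refl σ) })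
⊈ᵇ⇒covers (true  ∷ τ) (true  ∷ σ) h = ⊈ᵇ⇒covers τ σ h

Σ-covers-below : ∀ (σ : Subset n) → Σ[ allSubsets n ] (λ τ → covers τ σ) ≡ ℕ→ℚ (card σ)
Σ-covers-below []                  = refl
Σ-covers-below {suc n} (false ∷ σ) = trans (Σ-allSubsets (λ τ → covers τ (false ∷ σ)))
  (trans (cong₂ _+_ (Σ-covers-below σ) (Σ-zero (allSubsets n))) (ℚP.+-identityʳ _))
Σ-covers-below {suc n} (true ∷ σ)  = trans (Σ-allSubsets (λ τ → covers τ (true ∷ σ)))
  (trans (cong₂ _+_ (Σ-allSubsets-δ σ) (Σ-covers-below σ)) (sym (ℕ→ℚ-suc (card σ))))

Σ-covers-above : ∀ (σ : Subset n) → Σ[ allSubsets n ] (covers σ) + ℕ→ℚ (card σ) ≡ ℕ→ℚ n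
Σ-covers-above []                  = refl
-- A vertex outside `σ` yields one new coface, counted by the `δ` sum.
Σ-covers-above {suc n} (false ∷ σ) = trans
  (cong (_+ ℕ→ℚ (card σ)) (trans (Σ-allSubsets (covers (false ∷ σ)))
    (cong (Σ[ allSubsets n ] (covers σ) +_)
      (trans (Σ-cong (allSubsets n) (λ ρ _ → δ-sym ρ σ)) (Σ-allSubsets-δ σ)))))
  (trans (lemma (Σ[ allSubsets n ] (covers σ)) (ℕ→ℚ (card σ)))
    (trans (cong (1ℚ +_) (Σ-covers-above σ)) (sym (ℕ→ℚ-suc n))))
  where
  lemma : ∀ a b → a + 1ℚ + b ≡ 1ℚ + (a + b)
  lemma = solve-∀ ℚ-ring
Σ-covers-above {suc n} (true ∷ σ)  = trans
  (cong₂ _+_ (trans (Σ-allSubsets (covers (true ∷ σ)))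
    (cong (_+ Σ[ allSubsets n ] (covers σ)) (Σ-zero (allSubsets n)))) (ℕ→ℚ-suc (card σ)))
  (trans (lemma (Σ[ allSubsets n ] (covers σ)) (ℕ→ℚ (card σ)))
    (trans (cong (1ℚ +_) (Σ-covers-above σ)) (sym (ℕ→ℚ-suc n))))
  where
  lemma : ∀ a b → 0ℚ + a + (1ℚ + b) ≡ 1ℚ + (a + b)
  lemma = solve-∀ ℚ-ring

sgn²≡1 : ∀ j → ℤ→ℚ (sgn j) * ℤ→ℚ (sgn j) ≡ 1ℚ
sgn²≡1 j with ±1 j
  where
  ±1 : ∀ j → sgn j ≡ ℤ.+ 1 ⊎ sgn j ≡ ℤ.- (ℤ.+ 1)
  ±1 zero = inj₁ refl
  ±1 (suc j) with ±1 j
  ... | inj₁ eq = inj₂ (cong ℤ.-_ eq)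
  ... | inj₂ eq = inj₁ (cong ℤ.-_ eq)
... | inj₁ eq rewrite eq = refl
... | inj₂ eq rewrite eq = refl

-- Names the pattern-matching function inside `bd`, so that the lemmas can refer to it.
incidence : Subset n → ℤ × Subset n → ℚ
incidence τ (c , t) = if t ==ˢ τ then ℤ→ℚ c else 0ℚ

-- At most one face of `σ` equals `τ`, so the sum is zero or a single sign, and squaring removes the
-- sign. The shift `j` is arbitrary because a leading vertex of `σ` increases it.
bd² : ∀ j (τ σ : Subset n) →
  Σ[ faces' j σ ] (incidence τ) * Σ[ faces' j σ ] (incidence τ) ≡ covers τ σ
bd² j []          []          = refl
bd² j (false ∷ τ) (false ∷ σ) =
  trans (cong₂ _*_ eq eq) (bd² j τ σ)
  where
  eq = Σ-map (incidence (false ∷ τ)) _ (faces' j σ)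
bd² j (true ∷ τ)  (false ∷ σ) = cong₂ _*_ eq eq
  where
  eq = trans (Σ-map (incidence (true ∷ τ)) _ (faces' j σ)) (Σ-zero (faces' j σ))
bd² j (false ∷ τ) (true ∷ σ)  = trans (cong₂ _*_ eq eq) square
  where
  eq : Σ[ faces' j (true ∷ σ) ] (incidence (false ∷ τ)) ≡ incidence τ (sgn (suc j) , σ)
  eq = trans (cong (incidence τ (sgn (suc j) , σ) +_)
      (trans (Σ-map (incidence (false ∷ τ)) _ (faces' (suc j) σ)) (Σ-zero (faces' (suc j) σ))))
    (ℚP.+-identityʳ _)
  square : incidence τ (sgn (suc j) , σ) * incidence τ (sgn (suc j) , σ) ≡ δ σ τ
  square with σ ==ˢ τ
  ... | true  = sgn²≡1 (suc j)
  ... | false = refl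
bd² j (true ∷ τ)  (true ∷ σ)  = trans (cong₂ _*_ eq eq) (bd² (suc j) τ σ)
  where
  eq = trans (ℚP.+-identityˡ _) (Σ-map (incidence (true ∷ τ)) _ (faces' (suc j) σ))

bd*bd≡covers : ∀ (τ σ : Subset n) → bd τ σ * bd τ σ ≡ covers τ σ
bd*bd≡covers τ σ = trans (cong₂ _*_ eq eq) (bd² 0 τ σ)
  where
  eq : bd τ σ ≡ Σ[ faces σ ] (incidence τ)
  eq = Σ-cong {g = incidence τ} (faces σ) (λ _ _ → refl)

Σ≤length-filter : ∀ {P : A → Set} (P? : Decidable P) {f : A → ℚ} xs →
  (∀ x → f x ≤ 1ℚ) → (∀ x → ¬ P x → f x ≡ 0ℚ) → Σ[ xs ] f ≤ ℕ→ℚ (length (filter P? xs))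
Σ≤length-filter P? []       f≤1 f≡0 = ≤-refl
Σ≤length-filter P? {f} (x ∷ xs) f≤1 f≡0 with P? x
... | yes _ = ≤-trans (ℚP.+-mono-≤ (f≤1 x) (Σ≤length-filter P? xs f≤1 f≡0))
  (≤-reflexive (sym (ℕ→ℚ-suc (length (filter P? xs)))))
... | no ¬p = subst₂ _≤_ (sym (trans (cong (_+ Σ[ xs ] f) (f≡0 x ¬p)) (ℚP.+-identityˡ (Σ[ xs ] f)))) refl
  (Σ≤length-filter P? xs f≤1 f≡0)

length-filter≤Σ : ∀ {P : A → Set} (P? : Decidable P) {f : A → ℚ} xs → (∀ x → 0ℚ ≤ f x) →
  (∀ x → x ∈ xs → P x → f x ≡ 1ℚ) → ℕ→ℚ (length (filter P? xs)) ≤ Σ[ xs ] f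
length-filter≤Σ P? []       0≤f f≡1 = ≤-refl
length-filter≤Σ P? {f} (x ∷ xs) 0≤f f≡1 with P? x
... | yes p = subst₂ _≤_ (sym (ℕ→ℚ-suc (length (filter P? xs)))) refl
  (ℚP.+-mono-≤ (≤-reflexive (sym (f≡1 x (here refl) p)))
    (length-filter≤Σ P? xs 0≤f (λ y y∈ → f≡1 y (there y∈))))
... | no _  = subst (_≤ f x + Σ[ xs ] f) (ℚP.+-identityˡ (ℕ→ℚ (length (filter P? xs))))
  (ℚP.+-mono-≤ (0≤f x) (length-filter≤Σ P? xs 0≤f (λ y y∈ → f≡1 y (there y∈))))

-- The sum over facets is enlarged from those in `Γ` to all subsets, where `Σ-covers-below`
-- evaluates it; each coface contributes at most 1.
Lap-diagonal-≤ : ∀ (Γ : SimplicialComplex n) k σ →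
  Lap Γ (suc k) σ σ ≤ ℕ→ℚ (card σ) + ℕ→ℚ (updeg Γ (suc k) σ)
Lap-diagonal-≤ {n} Γ k σ = ℚP.+-mono-≤
  (≤-trans (Σ-filter-≤ _ (allSubsets n) (λ τ → square-nonneg (bd τ σ)))
    (≤-reflexive (trans (Σ-cong (allSubsets n) (λ τ _ → bd*bd≡covers τ σ)) (Σ-covers-below σ))))
  (≤-trans (≤-reflexive (Σ-cong (S Γ (suc (suc k))) (λ ρ _ → bd*bd≡covers σ ρ)))
    (Σ≤length-filter _ (S Γ (suc (suc k))) (covers≤1 σ) (⊈ᵇ⇒covers σ)))

updeg+card≤n : ∀ (Γ : SimplicialComplex n) k σ → σ ∈ S Γ k →
  ℕ→ℚ (updeg Γ k σ ℕ.+ suc k) ≤ ℕ→ℚ n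
updeg+card≤n {n} Γ k σ σ∈ = subst₂ _≤_
  (trans (cong (λ c → ℕ→ℚ (updeg Γ k σ) + ℕ→ℚ c) (∈S⇒card Γ k σ∈)) (sym (ℕ→ℚ-+ (updeg Γ k σ) (suc k))))
  (Σ-covers-above σ)
  (ℚP.+-monoˡ-≤ (ℕ→ℚ (card σ)) (≤-trans
    (length-filter≤Σ _ (S Γ (suc k)) (covers-nonneg σ) (λ ρ ρ∈ σ⊆ρ → ⊆ᵇ⇒covers σ ρ σ⊆ρ
      (trans (∈S⇒card Γ (suc k) ρ∈) (cong suc (sym (∈S⇒card Γ k σ∈))))))
    (Σ-filter-≤ _ (allSubsets n) (covers-nonneg σ))))

foldr-⊔-upper : ∀ (f : A → ℕ) xs {x} → x ∈ xs → f x ℕ.≤ foldr (λ y acc → f y ℕ.⊔ acc) 0 xs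
foldr-⊔-upper f (x ∷ xs) (here refl) = ℕP.m≤m⊔n (f x) _
foldr-⊔-upper f (y ∷ xs) (there x∈)  = ℕP.≤-trans (foldr-⊔-upper f xs x∈) (ℕP.m≤n⊔m (f y) _)

-- The maximum is one of the values or the initial value 0, hence the hypothesis `P 0`.
foldr-⊔-induction : ∀ (P : ℕ → Set) (f : A → ℕ) xs → P 0 → (∀ x → x ∈ xs → P (f x)) →
  P (foldr (λ y acc → f y ℕ.⊔ acc) 0 xs)
foldr-⊔-induction P f []       p0 pf = p0
foldr-⊔-induction P f (x ∷ xs) p0 pf
  with ℕP.⊔-sel (f x) (foldr (λ y acc → f y ℕ.⊔ acc) 0 xs)
... | inj₁ eq = subst P (sym eq) (pf x (here refl))
... | inj₂ eq = subst P (sym eq) (foldr-⊔-induction P f xs p0 (λ y y∈ → pf y (there y∈)))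

dup+card≤n : ∀ (Γ : SimplicialComplex n) k σ → σ ∈ S Γ k → ℕ→ℚ (dup Γ k ℕ.+ suc k) ≤ ℕ→ℚ n
dup+card≤n {n} Γ k σ σ∈ = foldr-⊔-induction (λ d → ℕ→ℚ (d ℕ.+ suc k) ≤ ℕ→ℚ n) (updeg Γ k) (S Γ k)
  -- For the initial value 0 the claim is that the `suc k` vertices of `σ` are among the `n`.
  (ℕ→ℚ-mono (ℕP.≤-trans (ℕP.≤-reflexive (sym (∈S⇒card Γ k σ∈))) (SubsetP.∣p∣≤n σ)))
  (updeg+card≤n Γ k)

module _ (Γ : SimplicialComplex n) (k : ℕ) where

  diagonalBound : ℚ
  diagonalBound = 1ℚ - (ℕ→ℚ (dup Γ (suc k) ℕ.+ suc k ℕ.+ 1) /ₜ ℕ→ℚ n)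

  private
    d+k+1 : dup Γ (suc k) ℕ.+ suc k ℕ.+ 1 ≡ dup Γ (suc k) ℕ.+ suc (suc k)
    d+k+1 = trans (ℕP.+-assoc (dup Γ (suc k)) (suc k) 1)
      (cong (dup Γ (suc k) ℕ.+_) (ℕP.+-comm (suc k) 1))

  diagonalBound-nonneg : ∀ σ → σ ∈ S Γ (suc k) → 0ℚ ≤ diagonalBound
  diagonalBound-nonneg σ σ∈ = ≤⇒0≤- {ℕ→ℚ D /ₜ ℕ→ℚ n} {1ℚ} (*-cancelʳ-≤ 0<n
    (subst₂ _≤_ (sym (/ₜ-*-cancel (ℕ→ℚ D) (pos⇒≢0 0<n))) (sym (ℚP.*-identityˡ (ℕ→ℚ n)))
      (subst (λ m → ℕ→ℚ m ≤ ℕ→ℚ n) (sym d+k+1) (dup+card≤n Γ (suc k) σ σ∈))))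
    where
    D = dup Γ (suc k) ℕ.+ suc k ℕ.+ 1
    -- The existence of `σ` forces `n` to be positive, so the division by `n` is a true one.
    0<n : 0ℚ < ℕ→ℚ n
    0<n = ℚP.<-≤-trans (ℕ→ℚ-pos (suc k)) (ℕ→ℚ-mono
      (ℕP.≤-trans (ℕP.≤-reflexive (sym (∈S⇒card Γ (suc k) σ∈))) (SubsetP.∣p∣≤n σ)))

  diagonalBound≤Hm : ∀ σ → σ ∈ S Γ (suc k) → diagonalBound ≤ Hm Γ (suc k) σ σ
  diagonalBound≤Hm σ σ∈ = ℚP.+-mono-≤ (≤-reflexive (sym (δ-refl σ)))
    (ℚP.neg-antimono-≤ (/ₜ-monoˡ (ℕ→ℚ-nonneg n) (≤-trans (Lap-diagonal-≤ Γ k σ)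
      (≤-trans (≤-reflexive (trans (sym (ℕ→ℚ-+ (card σ) (updeg Γ (suc k) σ)))
          (cong ℕ→ℚ (ℕP.+-comm (card σ) (updeg Γ (suc k) σ)))))
        (ℕ→ℚ-mono (ℕP.≤-trans
          (ℕP.+-mono-≤ (foldr-⊔-upper (updeg Γ (suc k)) (S Γ (suc k)) σ∈)
                       (ℕP.≤-reflexive (∈S⇒card Γ (suc k) σ∈)))
          (ℕP.≤-reflexive (sym d+k+1))))))))

-- The Markov chain on k-simplices

-- `sgnH Γ k σ τ` unfolds to this function at the entry `Hm Γ k σ τ`.
signℚ : ℚ → ℚ
signℚ p = if ⌊ p ℚP.<? 0ℚ ⌋ then ℚ.- 1ℚ else 1ℚ

signℚ*∣∣ : ∀ p → signℚ p * ∣ p ∣ ≡ p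
signℚ*∣∣ p with p ℚP.<? 0ℚ
... | yes p<0 = trans
  (cong (ℚ.- 1ℚ *_) (trans (sym (ℚP.∣-p∣≡∣p∣ p)) (ℚP.0≤p⇒∣p∣≡p (ℚP.neg-antimono-≤ (ℚP.<⇒≤ p<0)))))
  (lemma p)
  where
  lemma : ∀ p → ℚ.- 1ℚ * ℚ.- p ≡ p
  lemma = solve-∀ ℚ-ring
... | no  p≮0 = trans (ℚP.*-identityˡ ∣ p ∣) (ℚP.0≤p⇒∣p∣≡p (ℚP.≮⇒≥ p≮0))

signℚ² : ∀ p → signℚ p * signℚ p ≡ 1ℚ
signℚ² p with p ℚP.<? 0ℚ
... | yes _ = refl
... | no  _ = refl

^-pos : ∀ m → 0ℚ < a → 0ℚ < a ^ℚ m
^-pos zero    _   = ℚP.positive⁻¹ 1ℚ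
^-pos (suc m) 0<a = *-pos 0<a (^-pos m 0<a)

square-^ : ∀ a m → (a * a) ^ℚ m ≡ a ^ℚ (2 ℕ.* m)
square-^ a m = trans (^-distribʳ-* m a a) (trans (sym (^-distribˡ-+ a m m))
  (cong (λ i → a ^ℚ (m ℕ.+ i)) (sym (ℕP.+-identityʳ m))))

[]-or-∈ : ∀ (xs : List A) → xs ≡ [] ⊎ ∃ (_∈ xs)
[]-or-∈ []       = inj₁ refl
[]-or-∈ (x ∷ xs) = inj₂ (x , here refl)

∈⇒length-pos : ∀ {x : A} xs → x ∈ xs → 0ℚ < ℕ→ℚ (length xs)
∈⇒length-pos (_ ∷ xs) _ = ℕ→ℚ-pos (length xs)

δ-idem : ∀ (σ τ : Subset n) → δ σ τ * δ σ τ ≡ δ σ τ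
δ-idem σ τ with σ ==ˢ τ
... | true  = refl
... | false = refl

module Walk {n : ℕ} (Γ : SimplicialComplex n) (k : ℕ) where

  states : List (Subset n)
  states = S Γ k

  open Kernel states

  H P : Subset n → Subset n → ℚ
  H = Hm Γ k
  P = Pm Γ k

  norm : Subset n → ℚ
  norm = norm1 Γ k

  Σ-δ-states : ∀ σ → σ ∈ states → (g : Subset n → ℚ) → Σ[ states ] (λ τ → δ σ τ * g τ) ≡ g σ
  Σ-δ-states = Σ-δ (S-unique Γ k)

  entries : (Subset n → Subset n → ℚ) → ℕ → Subset n → Subset n → ℚ
  entries = entry δ δ-sym Σ-δ-states

  Lap-sym : ∀ k σ τ → Lap Γ k σ τ ≡ Lap Γ k τ σ
  Lap-sym zero    σ τ = Σ-cong (S Γ 1) (λ ρ _ → ℚP.*-comm (bd σ ρ) (bd τ ρ))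
  Lap-sym (suc k) σ τ = cong₂ _+_
    (Σ-cong (S Γ k) (λ ρ _ → ℚP.*-comm (bd ρ σ) (bd ρ τ)))
    (Σ-cong (S Γ (suc (suc k))) (λ ρ _ → ℚP.*-comm (bd σ ρ) (bd τ ρ)))

  -- The transition probabilities read `H τ σ` and the signs read `H σ τ`; symmetry reconciles the
  -- two.
  H-sym : ∀ σ τ → H σ τ ≡ H τ σ
  H-sym σ τ = cong₂ (λ d l → d - (l /ₜ ℕ→ℚ n)) (δ-sym σ τ) (Lap-sym k σ τ)

  norm-nonneg : ∀ σ → 0ℚ ≤ norm σ
  norm-nonneg σ = Σ-nonneg states (λ τ _ → ℚP.0≤∣p∣ (H τ σ))

  norm≡0⇒∣H∣≡0 : ∀ σ τ → norm σ ≡ 0ℚ → τ ∈ states → ∣ H τ σ ∣ ≡ 0ℚ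
  norm≡0⇒∣H∣≡0 σ τ norm≡0 τ∈ = ℚP.≤-antisym
    (≤-trans (∈⇒≤Σ states (λ ρ → ℚP.0≤∣p∣ (H ρ σ)) τ∈) (≤-reflexive norm≡0))
    (ℚP.0≤∣p∣ (H τ σ))

  P-nonneg : ∀ σ τ → 0ℚ ≤ P σ τ
  P-nonneg σ τ with norm1 Γ k σ ℚP.≟ 0ℚ
  ... | yes _ = δ-nonneg σ τ
  ... | no  _ = /ₜ-nonneg (ℚP.0≤∣p∣ (H τ σ)) (norm-nonneg σ)

  Σ-P : ∀ σ → σ ∈ states → Σ[ states ] (P σ) ≡ 1ℚ
  Σ-P σ σ∈ with norm1 Γ k σ ℚP.≟ 0ℚ
  ... | yes _  = trans (Σ-cong states (λ τ _ → sym (ℚP.*-identityʳ (δ σ τ))))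
    (Σ-δ-states σ σ∈ (λ _ → 1ℚ))
  ... | no ≢0 = trans (Σ-cong states (λ τ _ → /ₜ≡*1/ₜ ∣ H τ σ ∣ (norm σ)))
    (trans (Σ-*ʳ (1ℚ /ₜ norm σ) (λ τ → ∣ H τ σ ∣) states)
      (trans (ℚP.*-comm (norm σ) (1ℚ /ₜ norm σ)) (/ₜ-*-cancel 1ℚ ≢0)))

  -- Where the norm is zero, `P` is `δ` by convention, but then `H τ σ` is zero as well, being a
  -- term of the norm.
  P*norm : ∀ σ τ → τ ∈ states → P σ τ * norm σ ≡ ∣ H τ σ ∣
  P*norm σ τ τ∈ with norm1 Γ k σ ℚP.≟ 0ℚ
  ... | yes ≡0 = trans (cong (δ σ τ *_) ≡0)
    (trans (ℚP.*-zeroʳ (δ σ τ)) (sym (norm≡0⇒∣H∣≡0 σ τ ≡0 τ∈)))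
  ... | no ≢0 = /ₜ-*-cancel ∣ H τ σ ∣ ≢0

  -- The factors that one step contributes to `prob` times `fk` and to `prob` times the square of
  -- `fk`, where the sign has squared to 1.
  signedStep squaredStep : Subset n → Subset n → ℚ
  signedStep  σ τ = P σ τ * (sgnH Γ k σ τ * norm σ)
  squaredStep σ τ = P σ τ * (norm σ * norm σ)

  signedStep≡H : ∀ σ τ → σ ∈ states → τ ∈ states → signedStep σ τ ≡ H σ τ
  signedStep≡H σ τ _ τ∈ = trans (lemma (P σ τ) (sgnH Γ k σ τ) (norm σ))
    (trans (cong (sgnH Γ k σ τ *_) (trans (P*norm σ τ τ∈) (cong ∣_∣ (H-sym τ σ))))
           (signℚ*∣∣ (H σ τ)))
    where
    lemma : ∀ p s v → p * (s * v) ≡ s * (p * v)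
    lemma = solve-∀ ℚ-ring

  q : ℚ
  q = 1ℚ /ₜ ℕ→ℚ (length states)

  q-nonneg : 0ℚ ≤ q
  q-nonneg = 1/ₜ-nonneg (ℕ→ℚ-nonneg (length states))

  amplitude : Subset n → Subset n → ℚ
  amplitude σ τ = sgnH Γ k σ τ * norm σ

  weight-* : ∀ k k′ s → weight (λ σ τ → k σ τ * k′ σ τ) s ≡ weight k s * weight k′ s
  weight-* k k′ s = Π-* (uncurry k) (uncurry k′) (steps s)

  Σ-closed-paths : ∀ (F : List (Subset n) → ℚ) c ℓ →
    (∀ σ s → F (σ ∷ s) ≡ q * (weight c (σ ∷ s) * δ (lastOr σ (σ ∷ s)) σ)) →
    Σ[ Paths Γ k ℓ ] F ≡ q * Σ[ states ] (λ σ → entries c ℓ σ σ)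
  Σ-closed-paths F c ℓ eq = trans (Σ-seqs F ℓ states) (trans
    (Σ-cong states (λ σ _ → trans (Σ-cong (seqs ℓ states) (λ s _ → eq σ s))
      (trans (Σ-*ˡ q (λ s → weight c (σ ∷ s) * δ (lastOr σ (σ ∷ s)) σ) (seqs ℓ states))
             (cong (q *_) (Σ-paths≡power c (λ τ → δ τ σ) σ ℓ σ)))))
    (Σ-*ˡ q (λ σ → entries c ℓ σ σ) states))

  Ef2≡ : ∀ ℓ → Ef2 Γ k ℓ ≡ q * Σ[ states ] (λ σ → entries squaredStep ℓ σ σ)
  Ef2≡ ℓ = Σ-closed-paths (λ path → prob Γ k path * (fk Γ k path * fk Γ k path)) squaredStep ℓ (λ σ s → let e = δ (lastOr σ (σ ∷ s)) σ in begin
    q * weight P (σ ∷ s) * (e * weight amplitude (σ ∷ s) * (e * weight amplitude (σ ∷ s)))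
      ≡⟨ lemma₁ q (weight P (σ ∷ s)) e (weight amplitude (σ ∷ s)) ⟩
    q * (weight P (σ ∷ s) * (weight amplitude (σ ∷ s) * weight amplitude (σ ∷ s)) * (e * e))
      ≡⟨ cong₂ (λ w e → q * (w * e)) (square-weight (σ ∷ s)) (δ-idem (lastOr σ (σ ∷ s)) σ) ⟩
    q * (weight squaredStep (σ ∷ s) * e) ∎)
    where
    open ≡-Reasoning
    lemma₁ : ∀ q p e w → q * p * (e * w * (e * w)) ≡ q * (p * (w * w) * (e * e))
    lemma₁ = solve-∀ ℚ-ring
    lemma₂ : ∀ s v → s * v * (s * v) ≡ s * s * (v * v)
    lemma₂ = solve-∀ ℚ-ring
    square-weight : ∀ s → weight P s * (weight amplitude s * weight amplitude s) ≡ weight squaredStep s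
    square-weight s = trans (cong (weight P s *_) (sym (weight-* amplitude amplitude s)))
      (trans (sym (weight-* P (λ σ τ → amplitude σ τ * amplitude σ τ) s))
        (Π-cong (steps s) (λ (σ , τ) → cong (P σ τ *_) (trans (lemma₂ (sgnH Γ k σ τ) (norm σ))
          (trans (cong (_* (norm σ * norm σ)) (signℚ² (H σ τ))) (ℚP.*-identityˡ _))))))

  Hpow≡entries : ∀ m σ τ → Hpow Γ k m σ τ ≡ entries H m σ τ
  Hpow≡entries zero    σ τ = refl
  Hpow≡entries (suc m) σ τ = Σ-cong states (λ ρ _ → cong (H σ ρ *_) (Hpow≡entries m ρ τ))

  mean≡avgTr : ∀ ℓ → Σ[ Paths Γ k ℓ ] (λ path → prob Γ k path * fk Γ k path) ≡ avgTr Γ k ℓ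
  mean≡avgTr ℓ = trans
    (Σ-closed-paths (λ path → prob Γ k path * fk Γ k path) signedStep ℓ (λ σ s → let e = δ (lastOr σ (σ ∷ s)) σ in trans
      (lemma q (weight P (σ ∷ s)) e (weight amplitude (σ ∷ s)))
      (cong (λ w → q * (w * e)) (sym (weight-* P amplitude (σ ∷ s))))))
    (trans (cong (q *_) (Σ-cong states (λ σ σ∈ →
        trans (power-cong signedStep≡H ℓ σ σ∈) (sym (Hpow≡entries ℓ σ σ)))))
      (trans (ℚP.*-comm q (trHpow Γ k ℓ)) (sym (/ₜ≡*1/ₜ (trHpow Γ k ℓ) (ℕ→ℚ (length states))))))
    where
    lemma : ∀ q p e w → q * p * (e * w) ≡ q * (p * w * e)
    lemma = solve-∀ ℚ-ring

  Σ-prob : ∀ ℓ → 0ℚ < ℕ→ℚ (length states) → Σ[ Paths Γ k ℓ ] (prob Γ k) ≡ 1ℚ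
  Σ-prob ℓ 0<N = begin
    Σ[ Paths Γ k ℓ ] (prob Γ k)
      ≡⟨ Σ-seqs (prob Γ k) ℓ states ⟩
    Σ[ states ] (λ σ → Σ[ seqs ℓ states ] (λ s → prob Γ k (σ ∷ s)))
      ≡⟨ Σ-cong states (λ σ σ∈ → trans
           (Σ-*ˡ q (λ s → weight P (σ ∷ s)) (seqs ℓ states))
           (cong (q *_) (total-weight {P} Σ-P ℓ σ σ∈))) ⟩
    Σ[ states ] (λ _ → q * 1ℚ)
      ≡⟨ trans (Σ-*ˡ q (λ _ → 1ℚ) states) (cong (q *_) (Σ-one states)) ⟩
    q * ℕ→ℚ (length states)
      ≡⟨ /ₜ-*-cancel 1ℚ (pos⇒≢0 0<N) ⟩
    1ℚ ∎
    where open ≡-Reasoning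

  prob-nonneg : ∀ s → 0ℚ ≤ prob Γ k s
  prob-nonneg s = *-nonneg q-nonneg (Π-nonneg {f = uncurry P} (steps s) (λ (σ , τ) → P-nonneg σ τ))

  upper-bound : ∀ m → Ef2 Γ k (suc m) ≤ avgNormPow Γ k (2 ℕ.* suc m)
  upper-bound m = subst₂ _≤_ (sym (Ef2≡ (suc m)))
    (cong (q *_) (Σ-cong states (λ σ _ → square-^ (norm σ) (suc m))))
    (*-monoˡ-≤ q-nonneg (closed-walks-≤ δ δ-sym Σ-δ-states {k = P} {u = λ σ → norm σ * norm σ}
      P-nonneg Σ-P (λ σ → square-nonneg (norm σ)) δ-nonneg δ≤1 m))

  -- Nonnegativity of `c` is asked for at a state because `diagonalBound-nonneg` derives it from a
  -- simplex; with no states both sides are zero.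
  lower-bound : ∀ c ℓ → (∀ σ → σ ∈ states → 0ℚ ≤ c × c ≤ H σ σ) →
    c ^ℚ ℓ * avgNormPow Γ k ℓ ≤ Ef2 Γ k ℓ
  lower-bound c ℓ c-bounds = subst₂ _≤_ lhs (sym (Ef2≡ ℓ))
    (*-monoˡ-≤ q-nonneg (Σ-mono states (λ σ σ∈ →
      ≤-trans (^-monoˡ ℓ (*-nonneg (proj₁ (c-bounds σ σ∈)) (norm-nonneg σ)) (diagonal σ σ∈))
        (diagonal-power δ δ-sym Σ-δ-states {k = squaredStep}
          (λ σ τ → *-nonneg (P-nonneg σ τ) (square-nonneg (norm σ))) δ-nonneg δ-refl ℓ σ σ∈))))
    where
    lemma : ∀ q x s → q * (x * s) ≡ x * (q * s)
    lemma = solve-∀ ℚ-ring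
    lhs : q * Σ[ states ] (λ σ → (c * norm σ) ^ℚ ℓ) ≡ c ^ℚ ℓ * avgNormPow Γ k ℓ
    lhs = trans (cong (q *_) (trans (Σ-cong states (λ σ _ → ^-distribʳ-* ℓ c (norm σ)))
        (Σ-*ˡ (c ^ℚ ℓ) (λ σ → norm σ ^ℚ ℓ) states)))
      (lemma q (c ^ℚ ℓ) (Σ[ states ] (λ σ → norm σ ^ℚ ℓ)))
    diagonal : ∀ σ → σ ∈ states → c * norm σ ≤ squaredStep σ σ
    diagonal σ σ∈ = ≤-trans
      (*-monoʳ-≤ (norm-nonneg σ) (≤-trans (proj₂ (c-bounds σ σ∈)) (p≤∣p∣ (H σ σ))))
      (≤-reflexive (trans (cong (_* norm σ) (sym (P*norm σ σ σ∈)))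
                          (ℚP.*-assoc (P σ σ) (norm σ) (norm σ))))

  -- For the case of zero samples, where the sample bound forces the average of norm powers to be at
  -- most 0: one nonzero norm would make it positive.
  norm-vanishes : ∀ m → avgNormPow Γ k m ≤ 0ℚ → ∀ σ → σ ∈ states → norm σ ≡ 0ℚ
  norm-vanishes m avg≤0 σ σ∈ = decidable-stable (norm σ ℚP.≟ 0ℚ)
    (λ norm≢0 → ℚP.<-irrefl refl (ℚP.<-≤-trans (0<avg norm≢0) avg≤0))
    where
    0<N : 0ℚ < ℕ→ℚ (length states)
    0<N = ∈⇒length-pos states σ∈
    q≢0 : q ≢ 0ℚ
    q≢0 q≡0 = ℚP.1≢0 (trans (sym (/ₜ-*-cancel 1ℚ (pos⇒≢0 0<N)))
      (trans (cong (_* ℕ→ℚ (length states)) q≡0) (ℚP.*-zeroˡ (ℕ→ℚ (length states)))))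
    0<avg : norm σ ≢ 0ℚ → 0ℚ < avgNormPow Γ k m
    0<avg norm≢0 = *-pos (nonneg∧≢0⇒pos q-nonneg q≢0)
      (ℚP.<-≤-trans (^-pos m (nonneg∧≢0⇒pos (norm-nonneg σ) norm≢0))
        (∈⇒≤Σ states (λ τ → ^-nonneg m (norm-nonneg τ)) σ∈))

  -- The exponent is a successor because the zeroth power has trace `length states` even when `H` is
  -- zero.
  avgTr-vanishes : ∀ m i → avgNormPow Γ k m ≤ 0ℚ → avgTr Γ k (suc i) ≡ 0ℚ
  avgTr-vanishes m i avg≤0 = trans (/ₜ≡*1/ₜ (trHpow Γ k (suc i)) (ℕ→ℚ (length states)))
    (trans (cong (_* q) trace≡0) (ℚP.*-zeroˡ q))
    where
    H≡0 : ∀ σ τ → σ ∈ states → τ ∈ states → H σ τ ≡ 0ℚ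
    H≡0 σ τ σ∈ τ∈ = ℚP.∣p∣≡0⇒p≡0 (H σ τ) (norm≡0⇒∣H∣≡0 τ σ (norm-vanishes m avg≤0 τ τ∈) σ∈)
    trace≡0 : trHpow Γ k (suc i) ≡ 0ℚ
    trace≡0 = trans (Σ-cong states (λ σ σ∈ → trans
        (Σ-cong states (λ τ τ∈ → trans (cong (_* Hpow Γ k i τ σ) (H≡0 σ τ σ∈ τ∈))
          (ℚP.*-zeroˡ (Hpow Γ k i τ σ))))
        (Σ-zero states)))
      (Σ-zero states)

  PrDev-no-samples : ∀ ℓ μ ε → μ ≡ 0ℚ → 0ℚ < ε → PrDev Γ k ℓ 0 μ ε ≡ 0ℚ
  -- The only outcome is the empty list, whose average `0ℚ /ₜ 0ℚ` is 0 by convention and equals `μ`.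
  PrDev-no-samples ℓ .0ℚ ε refl 0<ε with ε ℚP.<? ∣ (0ℚ /ₜ 0ℚ) - 0ℚ ∣
  ... | no  _   = refl
  ... | yes ε<0 = contradiction (ℚP.<-trans 0<ε ε<0) (ℚP.<-irrefl refl)

  PrDev-no-states : ∀ ℓ N μ ε → states ≡ [] → PrDev Γ k ℓ (suc N) μ ε ≡ 0ℚ
  PrDev-no-states ℓ N μ ε eq = cong (λ Ω → Σ[ Ω ] outcome)
    (seqs-[] N (seqs-[] ℓ eq))
    where
    outcome : List (List (Subset n)) → ℚ
    outcome samples = if ⌊ ε ℚP.<? ∣ (Σ[ samples ] (fk Γ k) /ₜ ℕ→ℚ (suc N)) - μ ∣ ⌋
      then Π[ samples ] (prob Γ k) else 0ℚ
    seqs-[] : ∀ {A : Set} m {xs : List A} → xs ≡ [] → seqs (suc m) xs ≡ []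
    seqs-[] m refl = refl

  estimate : ∀ m ε η → 0ℚ < ε → 0ℚ < η → ∀ N →
    (1ℚ /ₜ (η * (ε * ε))) * avgNormPow Γ k (2 ℕ.* suc m) ≤ ℕ→ℚ N →
    PrDev Γ k (suc m) N (avgTr Γ k (suc m)) ε < η
  estimate m ε η 0<ε 0<η zero v≤0 = ℚP.≤-<-trans (≤-reflexive
    (PrDev-no-samples (suc m) (avgTr Γ k (suc m)) ε (avgTr-vanishes (2 ℕ.* suc m) m avg≤0) 0<ε)) 0<η
    where
    0<c : 0ℚ < η * (ε * ε)
    0<c = *-pos 0<η (*-pos 0<ε 0<ε)
    avg≤0 : avgNormPow Γ k (2 ℕ.* suc m) ≤ 0ℚ
    avg≤0 = ≤-trans (1/ₜ-*-≤ 0<c v≤0) (≤-reflexive (ℚP.*-zeroʳ (η * (ε * ε))))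
  estimate m ε η 0<ε 0<η (suc N) v≤N = [ no-states , some-state ]′ ([]-or-∈ states)
    where
    no-states : states ≡ [] → PrDev Γ k (suc m) (suc N) (avgTr Γ k (suc m)) ε < η
    no-states eq = ℚP.≤-<-trans
      (≤-reflexive (PrDev-no-states (suc m) N (avgTr Γ k (suc m)) ε eq)) 0<η
    some-state : ∃ (_∈ states) → PrDev Γ k (suc m) (suc N) (avgTr Γ k (suc m)) ε < η
    some-state (_ , σ∈) = Chebyshev.tail-bound (Paths Γ k (suc m)) (prob Γ k) prob-nonneg
      (Σ-prob (suc m) (∈⇒length-pos states σ∈)) (fk Γ k) (avgTr Γ k (suc m)) (mean≡avgTr (suc m))
      N 0<ε 0<η (upper-bound m) v≤N

theorem5 : (n : ℕ) (Γ : SimplicialComplex n) (k : ℕ) → 0 ℕ.< k →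
    (ℓ : ℕ) → 1 ℕ.≤ ℓ →
    ((((1ℚ - (ℕ→ℚ (dup Γ k ℕ.+ k ℕ.+ 1) /ₜ ℕ→ℚ n)) ^ℚ ℓ) * avgNormPow Γ k ℓ
    ≤ Ef2 Γ k ℓ)
    × (Ef2 Γ k ℓ ≤ avgNormPow Γ k (2 ℕ.* ℓ)))
    × ((ε η : ℚ) → 0ℚ < ε → 0ℚ < η → (Np : ℕ) →
    (1ℚ /ₜ (η * (ε * ε))) * avgNormPow Γ k (2 ℕ.* ℓ) ≤ ℕ→ℚ Np →
    PrDev Γ k ℓ Np (avgTr Γ k ℓ) ε < η)
theorem5 n Γ (suc k) _ (suc m) _ =
  (lower-bound (diagonalBound Γ k) (suc m) (λ σ σ∈ →
      diagonalBound-nonneg Γ k σ σ∈ , diagonalBound≤Hm Γ k σ σ∈)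
    , upper-bound m)
  , estimate m
  where open Walk Γ (suc k)
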